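{- For every integer $t\ge2$ there exists $\varepsilon_0>0$ such that for every $0<\varepsilon\le\varepsilon_0$ there exists $n_0$ such that for all $n\ge n_0$: any red-blue $K_n$ containing more than $(1-\varepsilon)\frac{n}{4t}\left(\frac{n-1}{2}\right)^{4t-1}$ alternating $4t$-cycles is $\delta$-bipartite, where $\delta=(4\varepsilon)^{1/32}$.
   Context: A red-blue $K_n$ is a complete graph on vertex set $V$, $|V|=n$, each edge coloured red or blue; $R$ and $B$ denote the graphs of red and blue edges. An alternating $4t$-cycle is a cycle with $4t$ edges (a subgraph) whose colours alternate red and blue around the cycle. For $0\le\delta\le1$, $G$ is $\delta$-bipartite if there is a partition $V=X\cup Y$ with (B1) $\lfloor n/2\rfloor-\delta n\le|X|,|Y|\le\lceil n/2\rceil+\delta n$, and (B2) either $|E(R)\triangle E(K_{X,Y})|\le\delta\binom n2$ or $|E(B)\triangle E(K_{X,Y})|\le\delta\binom n2$, where $K_{X,Y}$ is the complete bipartite graph with parts $X,Y$ and $\triangle$ is symmetric difference.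
   Formalization: The parameter ε (and the threshold ε₀) ranges over rational numbers instead of real numbers; inequalities involving δ = (4ε)^{1/32} are stated exactly by comparing 32nd powers. -}

module Defs where

open import Data.Bool using (Bool; true; false; not; _∧_; _xor_; if_then_else_)
open import Data.Nat as ℕ using (ℕ; zero; suc; ⌊_/2⌋; ⌈_/2⌉)
open import Data.Integer using (+_)
open import Data.Fin using (Fin; toℕ)
open import Data.Fin.Subset using (Subset; _∈_) renaming (∣_∣ to card)
open import Data.List using (List; []; _∷_; [_]; map; concatMap; allFin; length)
open import Data.Nat.ListAction using (sum)
open import Data.Vec using (Vec; lookup; toList) renaming ([] to []ᵥ; _∷_ to _∷ᵥ_)
open import Data.Rational using (ℚ; _/_; _*_; _-_; _≤_; 0ℚ; 1ℚ)
open import Data.Sum using (_⊎_)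
open import Data.Product using (Σ; _×_)
open import Relation.Nullary.Decidable using (⌊_⌋)

-- A red-blue colouring of K_n: c i j = true means the edge ij is red,
-- false means blue.  Only off-diagonal values matter; symmetry is a
-- hypothesis of the theorem.
Colouring : ℕ → Set
Colouring n = Fin n → Fin n → Bool

ℕ→ℚ : ℕ → ℚ
ℕ→ℚ k = + k / 1

-- k / d as a rational (d ≥ 1; the value at d = 0 is irrelevant and set to 0)
_÷ℕ_ : ℕ → ℕ → ℚ
k ÷ℕ zero = 0ℚ
k ÷ℕ suc d = + k / suc d

_^ℚ_ : ℚ → ℕ → ℚ
q ^ℚ zero = 1ℚ
q ^ℚ suc k = q * (q ^ℚ k)

count : {A : Set} → (A → Bool) → List A → ℕ
count p [] = 0
count p (x ∷ xs) = if p x then suc (count p xs) else count p xs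

allVecs : (n m : ℕ) → List (Vec (Fin n) m)
allVecs n zero = [ []ᵥ ]
allVecs n (suc m) = concatMap (λ v → map (λ x → x ∷ᵥ v) (allFin n)) (allVecs n m)

notIn : {n : ℕ} → Fin n → List (Fin n) → Bool
notIn x [] = true
notIn x (y ∷ ys) = not ⌊ x Data.Fin.≟ y ⌋ ∧ notIn x ys

allDistinct : {n : ℕ} → List (Fin n) → Bool
allDistinct [] = true
allDistinct (x ∷ xs) = notIn x xs ∧ allDistinct xs

altWalk : {n : ℕ} → Colouring n → Bool → Fin n → List (Fin n) → Bool
altWalk c b v0 [] = true
altWalk c b v0 (x ∷ []) = not (c x v0 xor b)
altWalk c b v0 (x ∷ y ∷ rest) = not (c x y xor b) ∧ altWalk c (not b) v0 (y ∷ rest)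

isRootedAlt : {n m : ℕ} → Colouring n → Vec (Fin n) m → Bool
isRootedAlt c v with toList v
... | [] = false
... | (x ∷ xs) = allDistinct (x ∷ xs) ∧ altWalk c true x (x ∷ xs)

rootedAltCount : (n : ℕ) → Colouring n → (t : ℕ) → ℕ
rootedAltCount n c t = count (isRootedAlt c) (allVecs n (4 ℕ.* t))

-- Number of alternating 4t-cycles (as subgraphs).  Each such cycle
-- (4t ≥ 8 edges) has exactly 4t·2 rooted orientations, of which exactly
-- half (4t) start with a red edge; so #cycles = rootedAltCount / (4t).
altCycles : (n : ℕ) → Colouring n → ℕ → ℚ
altCycles n c zero = 0ℚ
altCycles n c (suc t) = + rootedAltCount n c (suc t) / (4 ℕ.* suc t)

-- "x ≤ a^{1/32} · y"  (for a ≥ 0, y ≥ 0): either x ≤ 0, or x^32 ≤ a · y^32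
LeRoot32 : ℚ → ℚ → ℚ → Set
LeRoot32 a x y = (x ≤ 0ℚ) ⊎ (x ^ℚ 32 ≤ a * (y ^ℚ 32))

countPairs : (n : ℕ) → (Fin n → Fin n → Bool) → ℕ
countPairs n p = sum (map (λ i → count (λ j → ⌊ toℕ i ℕ.<? toℕ j ⌋ ∧ p i j) (allFin n)) (allFin n))

crossing : {n : ℕ} → Subset n → Fin n → Fin n → Bool
crossing X i j = lookup X i xor lookup X j

symDiffRed : (n : ℕ) → Colouring n → Subset n → ℕ
symDiffRed n c X = countPairs n (λ i j → c i j xor crossing X i j)

symDiffBlue : (n : ℕ) → Colouring n → Subset n → ℕ
symDiffBlue n c X = countPairs n (λ i j → not (c i j) xor crossing X i j)

choose2 : ℕ → ℚ
choose2 n = + (n ℕ.* (n ℕ.∸ 1)) / 2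

-- G is δ-bipartite with δ = a^{1/32} (δ ≥ 0); Y is the complement of X.
-- (B1) ⌊n/2⌋ - δn ≤ |X|,|Y| ≤ ⌈n/2⌉ + δn
-- (B2) |E(R) △ E(K_{X,Y})| ≤ δ·C(n,2)  or  |E(B) △ E(K_{X,Y})| ≤ δ·C(n,2)
SizeOK : ℚ → ℕ → ℕ → Set
SizeOK a n z = LeRoot32 a (ℕ→ℚ ⌊ n /2⌋ - ℕ→ℚ z) (ℕ→ℚ n)
             × LeRoot32 a (ℕ→ℚ z - ℕ→ℚ ⌈ n /2⌉) (ℕ→ℚ n)

DeltaBipartiteRoot32 : ℚ → (n : ℕ) → Colouring n → Set
DeltaBipartiteRoot32 a n c =
  Σ (Subset n) λ X →
    SizeOK a n (card X) × SizeOK a n (n ℕ.∸ card X)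
    × (LeRoot32 a (ℕ→ℚ (symDiffRed n c X)) (choose2 n)
       ⊎ LeRoot32 a (ℕ→ℚ (symDiffBlue n c X)) (choose2 n))

{-# OPTIONS --safe #-}
module Submission where

-- Let N = n, h = N/2, and let s be the ±1 matrix of the colouring with row sums D.
--
-- An alternating closed walk u₀ u₁ … u_k (k + 1 = 4t) is run through by two random walks that leave
-- each of u₁, …, u_k: one forwards from u₁ to u₀ and one backwards from u_k to u₀.  The product of their
-- probabilities is ∏ 1/(d_R d_B)(uᵢ) ≥ h^(-2k), so by AM-GM there are at most N h^k such walks, and
-- inserting the factor 4 d_R d_B(u₁)/N² = 1 − D(u₁)²/N² shows that Σ D² ≤ 4 ε N³ if the bound is almost attained.
--
-- Once Σ |D| is small, there are about N h^(k-2) alternating walks u₂ … u_k, and the number of pairs (u₀, u₁)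
-- that close one of them is (N² + z s y)/8 up to small terms, where y and z are ± the columns of s at u₂ and u_k.
-- So some walk has z s y ≥ (1 − η) N², i.e. s is close to a rank one matrix; symmetry of s forces z ≈ ± y.
-- Hence s ≈ ± y yᵀ, the parts are {y = 1} and {y = −1}, and they are balanced since (Σ y)² ≈ ± Σ s ≈ 0.

open import Defs
open import Data.Nat using (ℕ; _≤_; _∸_; _*_)
open import Data.Bool using (true)
open import Data.Fin using (Fin)
open import Data.Product using (Σ; _×_)
open import Data.Rational using (ℚ; _<_; _-_; 0ℚ; 1ℚ) renaming (_≤_ to _≤ℚ_; _*_ to _·_)
open import Relation.Binary.PropositionalEquality using (_≡_)

open import Data.Bool using (Bool; false; not; _∧_; _xor_)
import Data.Bool.Properties as Bool
open import Data.Fin using (toℕ)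
open import Data.Fin.Subset using (Subset) renaming (∣_∣ to card)
open import Data.Fin.Subset.Properties using (∣p∣≤n)
open import Data.Integer using (+[1+_])
import Data.Integer as ℤ
import Data.Integer.Properties as ℤ
open import Data.List using (List; []; _∷_; _++_; map; concatMap; allFin; length)
open import Data.List.Membership.Propositional using (_∈_)
open import Data.List.Membership.Propositional.Properties using (∈-allFin)
import Data.List.Properties as List
open import Data.List.Relation.Unary.Any using (here; there)
open import Data.Maybe using (Maybe; just; nothing)
open import Data.Nat using (zero; suc; z≤n; s≤s; ⌊_/2⌋; ⌈_/2⌉)
import Data.Nat as ℕ
import Data.Nat.Coprimality as Coprime
open import Data.Nat.ListAction using (sum)
import Data.Nat.Properties as ℕ
open import Data.Product using (_,_; proj₁; proj₂)
open import Data.Rational using (_+_; -_; ½; ∣_∣; 1/_; _/_; mkℚ; ↧ₙ_; toℚᵘ; nonNegative; positive; ≢-nonZero)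
open import Data.Rational.Properties
import Data.Rational.Unnormalised as ℚᵘ
import Data.Rational.Unnormalised.Properties as ℚᵘ
open import Data.Sum using (_⊎_; inj₁; inj₂; [_,_]′)
open import Data.Vec using (Vec; head; toList; lookup; tabulate) renaming ([] to []ᵥ; _∷_ to _∷ᵥ_)
open import Data.Vec.Properties using (lookup∘tabulate)
open import Level using (0ℓ)
open import Relation.Binary.PropositionalEquality using (refl; sym; trans; cong; cong₂; subst; subst₂; module ≡-Reasoning)
open import Relation.Nullary using (yes; no; contradiction)
open import Relation.Nullary.Decidable using (⌊_⌋)
open import Tactic.RingSolver using (solve-∀)
open import Tactic.RingSolver.Core.AlmostCommutativeRing using (AlmostCommutativeRing; fromCommutativeRing)

-- Distinctness of the vertices is discarded at once: closed walks, which may repeat vertices and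
-- use the diagonal entries `c i i` as coloured loops, already obey the bound N h^k, and replacing
-- (n - 1)/2 by n/2 costs only another factor 1 - ε once n ≥ k/ε. Square roots are the obstacle over
-- the rationals. The average e of |D|/N is rational but is controlled only through e² ≤ 4ε. So the
-- gap η, by which the best closing count misses its maximum, is defined from the colouring as 4ε +
-- C e, not as a multiple of √ε, and ε re-enters only through squares. The symmetric difference
-- comes out of order √ε times n² and the imbalance of the parts of order ε^(1/4) times n. Compared
-- with the exponent 1/32 this leaves a wide margin, which swallows all constants for small ε. Those
-- constants contain 2^m because some error sums over alternating paths are bounded by sums over all
-- sequences, and N^m = 2^m h^m.

ℚ-ring : AlmostCommutativeRing 0ℓ 0ℓ
ℚ-ring = fromCommutativeRing +-*-commutativeRing isZero
  where
  isZero : ∀ x → Maybe (0ℚ ≡ x)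
  isZero x with 0ℚ ≟ x
  ... | yes 0≡x = just 0≡x
  ... | no _    = nothing

-- Arithmetic in the ordered field of rationals

2ℚ 3ℚ 4ℚ 6ℚ 8ℚ 11ℚ 36ℚ : ℚ
2ℚ  = 1ℚ + 1ℚ
3ℚ  = 2ℚ + 1ℚ
4ℚ  = 2ℚ + 2ℚ
6ℚ  = ℕ→ℚ 6
8ℚ  = 2ℚ · 2ℚ · 2ℚ
11ℚ = ℕ→ℚ 11
36ℚ = ℕ→ℚ 36

0≤1 : 0ℚ ≤ℚ 1ℚ
0≤1 = nonNegative⁻¹ 1ℚ

p≤q⇒0≤q-p : ∀ {p q} → p ≤ℚ q → 0ℚ ≤ℚ q - p
p≤q⇒0≤q-p {p} {q} p≤q = subst (_≤ℚ q - p) (+-inverseʳ p) (+-monoˡ-≤ (- p) p≤q)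

≤-from-difference : ∀ {p q d} → 0ℚ ≤ℚ d → q - p ≡ d → p ≤ℚ q
≤-from-difference {p} {q} {d} 0≤d q-p≡d =
  subst₂ _≤ℚ_ (+-identityʳ p) (trans (cong (λ e → p + e) (sym q-p≡d)) (p+[q-p] p q)) (+-monoʳ-≤ p 0≤d)
  where
  p+[q-p] : ∀ p q → p + (q - p) ≡ q
  p+[q-p] = solve-∀ ℚ-ring

+-nonNeg : ∀ {p q} → 0ℚ ≤ℚ p → 0ℚ ≤ℚ q → 0ℚ ≤ℚ p + q
+-nonNeg = +-mono-≤

·-monoˡ-≤ : ∀ {r p q} → 0ℚ ≤ℚ r → p ≤ℚ q → r · p ≤ℚ r · q
·-monoˡ-≤ {r} 0≤r = *-monoˡ-≤-nonNeg r {{nonNegative 0≤r}}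

·-monoʳ-≤ : ∀ {r p q} → 0ℚ ≤ℚ r → p ≤ℚ q → p · r ≤ℚ q · r
·-monoʳ-≤ {r} 0≤r = *-monoʳ-≤-nonNeg r {{nonNegative 0≤r}}

·-nonNeg : ∀ {p q} → 0ℚ ≤ℚ p → 0ℚ ≤ℚ q → 0ℚ ≤ℚ p · q
·-nonNeg {p} {q} 0≤p 0≤q = subst (_≤ℚ p · q) (*-zeroʳ p) (·-monoˡ-≤ 0≤p 0≤q)

·-pos : ∀ {p q} → 0ℚ < p → 0ℚ < q → 0ℚ < p · q
·-pos {p} {q} 0<p 0<q = subst (_< p · q) (*-zeroʳ p) (*-monoʳ-<-pos p {{positive 0<p}} 0<q)

·-mono-≤ : ∀ {p q r s} → 0ℚ ≤ℚ p → 0ℚ ≤ℚ r → p ≤ℚ q → r ≤ℚ s → p · r ≤ℚ q · s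
·-mono-≤ 0≤p 0≤r p≤q r≤s = ≤-trans (·-monoʳ-≤ 0≤r p≤q) (·-monoˡ-≤ (≤-trans 0≤p p≤q) r≤s)

·-cancelˡ-≤ : ∀ {r p q} → 0ℚ < r → r · p ≤ℚ r · q → p ≤ℚ q
·-cancelˡ-≤ {r} 0<r = *-cancelˡ-≤-pos r {{positive 0<r}}

neg-involutive : ∀ p → - - p ≡ p
neg-involutive = solve-∀ ℚ-ring

neg-·-neg : ∀ p → (- p) · (- p) ≡ p · p
neg-·-neg = solve-∀ ℚ-ring

p<q∧q≤p⇒⊥ : ∀ {p q} {A : Set} → p < q → q ≤ℚ p → A
p<q∧q≤p⇒⊥ p<q q≤p = contradiction (<-≤-trans p<q q≤p) (<-irrefl refl)

·-interchange : ∀ a b c d → a · b · (c · d) ≡ a · c · (b · d)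
·-interchange = solve-∀ ℚ-ring

square-nonNeg : ∀ p → 0ℚ ≤ℚ p · p
square-nonNeg p with ≤-total 0ℚ p
... | inj₁ 0≤p = ·-nonNeg 0≤p 0≤p
... | inj₂ p≤0 = subst (0ℚ ≤ℚ_) (neg-·-neg p) (·-nonNeg 0≤-p 0≤-p)
  where
  0≤-p : 0ℚ ≤ℚ - p
  0≤-p = neg-antimono-≤ p≤0

square-cancel-≤ : ∀ {p q} → 0ℚ ≤ℚ q → p · p ≤ℚ q · q → p ≤ℚ q
square-cancel-≤ {p} {q} 0≤q p²≤q² with ≤-total p q
... | inj₁ p≤q = p≤q
... | inj₂ q≤p with q ≟ p
...   | yes q≡p = ≤-reflexive (sym q≡p)
...   | no  q≢p = p<q∧q≤p⇒⊥ (≤-<-trans (·-monoˡ-≤ 0≤q q≤p) (*-monoˡ-<-pos p {{positive 0<p}} q<p)) p²≤q²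
  where
  q<p : q < p
  q<p = ≰⇒> λ p≤q → q≢p (≤-antisym q≤p p≤q)
  0<p : 0ℚ < p
  0<p = ≤-<-trans 0≤q q<p

p≤∣p∣ : ∀ p → p ≤ℚ ∣ p ∣
p≤∣p∣ p with ∣p∣≡p∨∣p∣≡-p p
... | inj₁ eq = ≤-reflexive (sym eq)
... | inj₂ eq = ≤-trans (subst (_≤ℚ 0ℚ) (neg-involutive p) (neg-antimono-≤ (subst (0ℚ ≤ℚ_) eq (0≤∣p∣ p)))) (0≤∣p∣ p)

-p≤∣p∣ : ∀ p → - p ≤ℚ ∣ p ∣
-p≤∣p∣ p = subst (- p ≤ℚ_) (∣-p∣≡∣p∣ p) (p≤∣p∣ (- p))

∣p∣·∣p∣≡p·p : ∀ p → ∣ p ∣ · ∣ p ∣ ≡ p · p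
∣p∣·∣p∣≡p·p p with ∣p∣≡p∨∣p∣≡-p p
... | inj₁ eq = cong₂ _·_ eq eq
... | inj₂ eq = trans (cong₂ _·_ eq eq) (neg-·-neg p)

-- Total, with value 0 at 0: a vertex without edges of some colour then gets transition weight 0 and
-- needs no separate treatment.
inv : ℚ → ℚ
inv p with p ≟ 0ℚ
... | yes _   = 0ℚ
... | no  p≢0 = (1/ p) {{≢-nonZero p≢0}}

inv-inverse : ∀ {p} → 0ℚ < p → p · inv p ≡ 1ℚ
inv-inverse {p} 0<p with p ≟ 0ℚ
... | yes p≡0 = contradiction (sym p≡0) (<⇒≢ 0<p)
... | no  p≢0 = *-inverseʳ p {{≢-nonZero p≢0}}

inv-nonNeg : ∀ {p} → 0ℚ ≤ℚ p → 0ℚ ≤ℚ inv p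
inv-nonNeg {p} 0≤p with p ≟ 0ℚ
... | yes _   = ≤-refl
... | no  p≢0 = <⇒≤ (positive⁻¹ _ {{1/pos⇒pos p {{positive 0<p}}}})
  where
  0<p : 0ℚ < p
  0<p = ≰⇒> λ p≤0 → p≢0 (≤-antisym p≤0 0≤p)

p·inv≤1 : ∀ p → p · inv p ≤ℚ 1ℚ
p·inv≤1 p with p ≟ 0ℚ
... | yes _   = subst (_≤ℚ 1ℚ) (sym (*-zeroʳ p)) 0≤1
... | no  p≢0 = ≤-reflexive (*-inverseʳ p {{≢-nonZero p≢0}})

^-nonNeg : ∀ {p} k → 0ℚ ≤ℚ p → 0ℚ ≤ℚ p ^ℚ k
^-nonNeg zero    0≤p = 0≤1
^-nonNeg (suc k) 0≤p = ·-nonNeg 0≤p (^-nonNeg k 0≤p)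

^-pos : ∀ {p} k → 0ℚ < p → 0ℚ < p ^ℚ k
^-pos zero    0<p = positive⁻¹ 1ℚ
^-pos (suc k) 0<p = ·-pos 0<p (^-pos k 0<p)

^-distrib-· : ∀ p q k → (p · q) ^ℚ k ≡ p ^ℚ k · q ^ℚ k
^-distrib-· p q zero    = refl
^-distrib-· p q (suc k) = trans (cong ((p · q) ·_) (^-distrib-· p q k)) (·-interchange p q (p ^ℚ k) (q ^ℚ k))

^-mono-≤ : ∀ {p q} k → 0ℚ ≤ℚ p → p ≤ℚ q → p ^ℚ k ≤ℚ q ^ℚ k
^-mono-≤ zero    0≤p p≤q = ≤-refl
^-mono-≤ (suc k) 0≤p p≤q = ·-mono-≤ 0≤p (^-nonNeg k 0≤p) p≤q (^-mono-≤ k 0≤p p≤q)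

^-+ : ∀ p j k → p ^ℚ (j ℕ.+ k) ≡ p ^ℚ j · p ^ℚ k
^-+ p zero    k = sym (*-identityˡ (p ^ℚ k))
^-+ p (suc j) k = trans (cong (p ·_) (^-+ p j k)) (sym (*-assoc p (p ^ℚ j) (p ^ℚ k)))

^-double : ∀ p k → p ^ℚ (k ℕ.+ k) ≡ (p · p) ^ℚ k
^-double p k = trans (^-+ p k k) (sym (^-distrib-· p p k))

1≤^ : ∀ {p} k → 1ℚ ≤ℚ p → 1ℚ ≤ℚ p ^ℚ k
1≤^ zero    1≤p = ≤-refl
1≤^ (suc k) 1≤p = ·-mono-≤ 0≤1 0≤1 1≤p (1≤^ k 1≤p)

-- `_/_` divides by a gcd and is stuck on variables, so the equation is checked among unnormalised
-- rationals.
a/[1+d]·[1+d]≡a : ∀ a d → ℕ→ℚ (suc d) · ((ℤ.+ a) / suc d) ≡ ℕ→ℚ a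
a/[1+d]·[1+d]≡a a d = toℚᵘ-injective (begin
  toℚᵘ (ℕ→ℚ (suc d) · ((ℤ.+ a) / suc d))               ≈⟨ toℚᵘ-homo-* (ℕ→ℚ (suc d)) ((ℤ.+ a) / suc d) ⟩
  toℚᵘ (ℕ→ℚ (suc d)) ℚᵘ.* toℚᵘ ((ℤ.+ a) / suc d)       ≈⟨ ℚᵘ.*-cong (toℚᵘ-fromℚᵘ (ℚᵘ.mkℚᵘ (ℤ.+ suc d) 0)) (toℚᵘ-fromℚᵘ (ℚᵘ.mkℚᵘ (ℤ.+ a) d)) ⟩
  ℚᵘ.mkℚᵘ (ℤ.+ suc d) 0 ℚᵘ.* ℚᵘ.mkℚᵘ (ℤ.+ a) d           ≈⟨ ℚᵘ.*≡* (rearrange (ℤ.+ suc d) (ℤ.+ a) (ℤ.+ suc (d ℕ.+ 0)) (cong (λ k → ℤ.+ suc k) (sym (ℕ.+-identityʳ d)))) ⟩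
  ℚᵘ.mkℚᵘ (ℤ.+ a) 0                                    ≈⟨ toℚᵘ-fromℚᵘ (ℚᵘ.mkℚᵘ (ℤ.+ a) 0) ⟨
  toℚᵘ (ℕ→ℚ a)                                       ∎)
  where
  open ℚᵘ.≃-Reasoning
  rearrange : ∀ i j k → i ≡ k → i ℤ.* j ℤ.* (ℤ.+ 1) ≡ j ℤ.* k
  rearrange i j k i≡k = trans (ℤ.*-identityʳ _) (trans (ℤ.*-comm i j) (cong (j ℤ.*_) i≡k))

ℕ→ℚ-mkℚ : ∀ k → ℕ→ℚ k ≡ mkℚ (ℤ.+ k) 0 (Coprime.sym (Coprime.1-coprimeTo k))
ℕ→ℚ-mkℚ k = normalize-coprime _

ℕ→ℚ-+ : ∀ a b → ℕ→ℚ (a ℕ.+ b) ≡ ℕ→ℚ a + ℕ→ℚ b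
ℕ→ℚ-+ a b = sym (trans (cong₂ _+_ (ℕ→ℚ-mkℚ a) (ℕ→ℚ-mkℚ b))
                       (cong (_/ 1) (cong₂ ℤ._+_ (ℤ.*-identityʳ (ℤ.+ a)) (ℤ.*-identityʳ (ℤ.+ b)))))

ℕ→ℚ-* : ∀ a b → ℕ→ℚ (a * b) ≡ ℕ→ℚ a · ℕ→ℚ b
ℕ→ℚ-* a b = sym (trans (cong₂ _·_ (ℕ→ℚ-mkℚ a) (ℕ→ℚ-mkℚ b)) (cong (_/ 1) (sym (ℤ.pos-* a b))))

ℕ→ℚ-nonNeg : ∀ k → 0ℚ ≤ℚ ℕ→ℚ k
ℕ→ℚ-nonNeg k = nonNegative⁻¹ (ℕ→ℚ k) {{normalize-nonNeg k 1}}

ℕ→ℚ-mono-≤ : ∀ {a b} → a ≤ b → ℕ→ℚ a ≤ℚ ℕ→ℚ b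
ℕ→ℚ-mono-≤ {a} {b} a≤b = subst₂ _≤ℚ_ (+-identityʳ _) (trans (sym (ℕ→ℚ-+ a (b ∸ a))) (cong ℕ→ℚ (ℕ.m+[n∸m]≡n a≤b)))
  (+-monoʳ-≤ (ℕ→ℚ a) (ℕ→ℚ-nonNeg (b ∸ a)))

ℕ→ℚ-∸ : ∀ {a b} → a ≤ b → ℕ→ℚ (b ∸ a) ≡ ℕ→ℚ b - ℕ→ℚ a
ℕ→ℚ-∸ {a} {b} a≤b = sym (trans (cong (λ k → ℕ→ℚ k - ℕ→ℚ a) (sym (ℕ.m+[n∸m]≡n a≤b)))
  (trans (cong (_- ℕ→ℚ a) (ℕ→ℚ-+ a (b ∸ a))) ([p+q]-p (ℕ→ℚ a) (ℕ→ℚ (b ∸ a)))))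
  where
  [p+q]-p : ∀ p q → p + q - p ≡ q
  [p+q]-p = solve-∀ ℚ-ring

-- A positive rational times its denominator is its numerator, hence at least 1; so `k` times the
-- denominator serves as threshold.
archimedean : ∀ {ε} → 0ℚ < ε → ∀ k → Σ ℕ λ n₀ → ∀ n → n₀ ≤ n → ℕ→ℚ k ≤ℚ ℕ→ℚ n · ε
archimedean {ε} 0<ε k = k * ↧ₙ ε , λ n n₀≤n → ≤-trans
  (subst₂ _≤ℚ_ (*-identityʳ _) (trans (sym (*-assoc (ℕ→ℚ k) _ ε)) (cong (_· ε) (sym (ℕ→ℚ-* k (↧ₙ ε)))))
    (·-monoˡ-≤ (ℕ→ℚ-nonNeg k) (1≤↧ₙε·ε ε 0<ε)))
  (·-monoʳ-≤ (<⇒≤ 0<ε) (ℕ→ℚ-mono-≤ n₀≤n))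
  where
  1≤↧ₙε·ε : ∀ ε → 0ℚ < ε → 1ℚ ≤ℚ ℕ→ℚ (↧ₙ ε) · ε
  1≤↧ₙε·ε ε 0<ε with positive 0<ε
  1≤↧ₙε·ε ε@(mkℚ +[1+ a ] d _) 0<ε | _ =
    subst (1ℚ ≤ℚ_) (trans (sym (a/[1+d]·[1+d]≡a (suc a) d)) (cong (ℕ→ℚ (suc d) ·_) (↥p/↧p≡p ε)))
      (ℕ→ℚ-mono-≤ (s≤s {n = a} z≤n))

bernoulli : ∀ {θ} k → 0ℚ ≤ℚ θ → θ ≤ℚ 1ℚ → 1ℚ - ℕ→ℚ k · θ ≤ℚ (1ℚ - θ) ^ℚ k
bernoulli {θ} zero    0≤θ θ≤1 = ≤-reflexive (identity θ)
  where
  identity : ∀ θ → 1ℚ - 0ℚ · θ ≡ 1ℚ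
  identity = solve-∀ ℚ-ring
bernoulli {θ} (suc k) 0≤θ θ≤1 = ≤-trans
  (≤-from-difference (·-nonNeg (ℕ→ℚ-nonNeg k) (square-nonNeg θ))
    (trans (cong (λ r → (1ℚ - θ) · (1ℚ - ℕ→ℚ k · θ) - (1ℚ - r · θ)) (ℕ→ℚ-+ 1 k)) (identity (ℕ→ℚ k) θ)))
  (·-monoˡ-≤ (p≤q⇒0≤q-p θ≤1) (bernoulli k 0≤θ θ≤1))
  where
  identity : ∀ k θ → (1ℚ - θ) · (1ℚ - k · θ) - (1ℚ - (1ℚ + k) · θ) ≡ k · (θ · θ)
  identity = solve-∀ ℚ-ring

-- Clears the denominator 4t, which occurs both in the bound and in the passage from rooted walks to
-- cycles.
÷-cancel-< : ∀ p q a r d → p · (a ÷ℕ suc d) · q < r ÷ℕ suc d → p · ℕ→ℚ a · q < ℕ→ℚ r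
÷-cancel-< p q a r d lt = subst₂ _<_
  (trans (rearrange (ℕ→ℚ (suc d)) p (a ÷ℕ suc d) q) (cong (λ x → p · x · q) (a/[1+d]·[1+d]≡a a d)))
  (a/[1+d]·[1+d]≡a r d)
  (*-monoʳ-<-pos (ℕ→ℚ (suc d)) {{normalize-pos (suc d) 1}} lt)
  where
  rearrange : ∀ k p a q → k · (p · a · q) ≡ p · (k · a) · q
  rearrange = solve-∀ ℚ-ring

-- Finite sums

private variable
  A B : Set

∑ : List A → (A → ℚ) → ℚ
∑ []       f = 0ℚ
∑ (x ∷ xs) f = f x + ∑ xs f

infix 5 ∑
syntax ∑ xs (λ x → e) = ∑[ x ← xs ] e

∑-cong : ∀ (xs : List A) {f g} → (∀ x → f x ≡ g x) → ∑ xs f ≡ ∑ xs g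
∑-cong []       f≗g = refl
∑-cong (x ∷ xs) f≗g = cong₂ _+_ (f≗g x) (∑-cong xs f≗g)

∑-mono-≤ : ∀ (xs : List A) {f g} → (∀ x → f x ≤ℚ g x) → ∑ xs f ≤ℚ ∑ xs g
∑-mono-≤ []       f≤g = ≤-refl
∑-mono-≤ (x ∷ xs) f≤g = +-mono-≤ (f≤g x) (∑-mono-≤ xs f≤g)

∑-nonNeg : ∀ (xs : List A) {f} → (∀ x → 0ℚ ≤ℚ f x) → 0ℚ ≤ℚ ∑ xs f
∑-nonNeg []       0≤f = ≤-refl
∑-nonNeg (x ∷ xs) 0≤f = +-nonNeg (0≤f x) (∑-nonNeg xs 0≤f)

term≤∑ : ∀ {xs : List A} {f y} → (∀ x → 0ℚ ≤ℚ f x) → y ∈ xs → f y ≤ℚ ∑ xs f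
term≤∑ {xs = _ ∷ xs} {f} {y} 0≤f (here refl)  = subst (_≤ℚ f y + ∑ xs f) (+-identityʳ (f y)) (+-monoʳ-≤ (f y) (∑-nonNeg xs 0≤f))
term≤∑ {xs = x ∷ xs} {f} {y} 0≤f (there y∈xs) = subst (_≤ℚ f x + ∑ xs f) (+-identityˡ (f y)) (+-mono-≤ (0≤f x) (term≤∑ 0≤f y∈xs))

∑-+ : ∀ (xs : List A) f g → ∑[ x ← xs ] (f x + g x) ≡ ∑ xs f + ∑ xs g
∑-+ []       f g = refl
∑-+ (x ∷ xs) f g = trans (cong ((f x + g x) +_) (∑-+ xs f g)) (interchange (f x) (g x) (∑ xs f) (∑ xs g))
  where
  interchange : ∀ a b c d → a + b + (c + d) ≡ a + c + (b + d)
  interchange = solve-∀ ℚ-ring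

∑-·ˡ : ∀ (xs : List A) a f → ∑[ x ← xs ] (a · f x) ≡ a · ∑ xs f
∑-·ˡ []       a f = sym (*-zeroʳ a)
∑-·ˡ (x ∷ xs) a f = trans (cong (a · f x +_) (∑-·ˡ xs a f)) (sym (*-distribˡ-+ a (f x) (∑ xs f)))

∑-·ʳ : ∀ (xs : List A) a f → ∑[ x ← xs ] (f x · a) ≡ ∑ xs f · a
∑-·ʳ xs a f = trans (∑-cong xs (λ x → *-comm (f x) a)) (trans (∑-·ˡ xs a f) (*-comm a (∑ xs f)))

∑-neg : ∀ (xs : List A) f → ∑[ x ← xs ] (- f x) ≡ - ∑ xs f
∑-neg []       f = refl
∑-neg (x ∷ xs) f = trans (cong (- f x +_) (∑-neg xs f)) (sym (neg-distrib-+ (f x) (∑ xs f)))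

∑-const : ∀ (xs : List A) a → ∑[ _ ← xs ] a ≡ ℕ→ℚ (length xs) · a
∑-const []       a = sym (*-zeroˡ a)
∑-const (x ∷ xs) a = trans (cong (a +_) (∑-const xs a))
  (trans (a+ka a (ℕ→ℚ (length xs))) (cong (_· a) (sym (ℕ→ℚ-+ 1 (length xs)))))
  where
  a+ka : ∀ a k → a + k · a ≡ (1ℚ + k) · a
  a+ka = solve-∀ ℚ-ring

∑-comm : ∀ (xs : List A) (ys : List B) (f : A → B → ℚ) → ∑[ x ← xs ] ∑[ y ← ys ] f x y ≡ ∑[ y ← ys ] ∑[ x ← xs ] f x y
∑-comm []       ys f = sym (trans (∑-const ys 0ℚ) (*-zeroʳ (ℕ→ℚ (length ys))))
∑-comm (x ∷ xs) ys f = trans (cong (∑ ys (f x) +_) (∑-comm xs ys f)) (sym (∑-+ ys (f x) (λ y → ∑[ x ← xs ] f x y)))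

∑-++ : ∀ (xs ys : List A) f → ∑ (xs ++ ys) f ≡ ∑ xs f + ∑ ys f
∑-++ []       ys f = sym (+-identityˡ _)
∑-++ (x ∷ xs) ys f = trans (cong (f x +_) (∑-++ xs ys f)) (sym (+-assoc (f x) (∑ xs f) (∑ ys f)))

∑-map : ∀ (g : A → B) xs f → ∑ (map g xs) f ≡ ∑[ x ← xs ] f (g x)
∑-map g []       f = refl
∑-map g (x ∷ xs) f = cong (f (g x) +_) (∑-map g xs f)

∑-concatMap : ∀ (g : A → List B) xs f → ∑ (concatMap g xs) f ≡ ∑[ x ← xs ] ∑ (g x) f
∑-concatMap g []       f = refl
∑-concatMap g (x ∷ xs) f = trans (∑-++ (g x) (concatMap g xs) f) (cong (∑ (g x) f +_) (∑-concatMap g xs f))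

∑-allVecs-suc : ∀ n k f → ∑ (allVecs n (suc k)) f ≡ ∑[ v ← allVecs n k ] ∑[ x ← allFin n ] f (x ∷ᵥ v)
∑-allVecs-suc n k f = trans (∑-concatMap _ (allVecs n k) f) (∑-cong (allVecs n k) λ v → ∑-map (_∷ᵥ v) (allFin n) f)

∑-allFin-const : ∀ n a → ∑[ _ ← allFin n ] a ≡ ℕ→ℚ n · a
∑-allFin-const n a = trans (∑-const (allFin n) a) (cong (λ k → ℕ→ℚ k · a) (List.length-tabulate {n = n} (λ i → i)))

∣∑∣≤∑∣∣ : ∀ (xs : List A) f → ∣ ∑ xs f ∣ ≤ℚ ∑[ x ← xs ] ∣ f x ∣
∣∑∣≤∑∣∣ []       f = ≤-refl
∣∑∣≤∑∣∣ (x ∷ xs) f = ≤-trans (∣p+q∣≤∣p∣+∣q∣ (f x) (∑ xs f)) (+-monoʳ-≤ ∣ f x ∣ (∣∑∣≤∑∣∣ xs f))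

-- Prepending `x` increases the difference of the two sides by the sum of the squares (f x - f y)².
∑-cauchy-schwarz : ∀ (xs : List A) f → ∑ xs f · ∑ xs f ≤ℚ ℕ→ℚ (length xs) · (∑[ x ← xs ] f x · f x)
∑-cauchy-schwarz []       f = ≤-refl
∑-cauchy-schwarz {A} (x ∷ xs) f = ≤-from-difference
  (+-nonNeg (p≤q⇒0≤q-p (∑-cauchy-schwarz xs f)) (∑-nonNeg xs λ y → square-nonNeg (f x - f y)))
  (trans (cong (λ k → k · (f x · f x + S₂) - (f x + S₁) · (f x + S₁)) (ℕ→ℚ-+ 1 (length xs)))
    (trans (expand (f x) S₁ S₂ L) (cong ((L · S₂ - S₁ · S₁) +_) (sym cross))))
  where
  S₁ S₂ L : ℚ
  S₁ = ∑ xs f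
  S₂ = ∑[ y ← xs ] f y · f y
  L  = ℕ→ℚ (length xs)
  expand : ∀ a s₁ s₂ l → (1ℚ + l) · (a · a + s₂) - (a + s₁) · (a + s₁) ≡ l · s₂ - s₁ · s₁ + (l · (a · a) + (- (a + a)) · s₁ + s₂)
  expand = solve-∀ ℚ-ring
  square : ∀ a b → (a - b) · (a - b) ≡ a · a + (- (a + a)) · b + b · b
  square = solve-∀ ℚ-ring
  cross : (∑[ y ← xs ] (f x - f y) · (f x - f y)) ≡ L · (f x · f x) + (- (f x + f x)) · S₁ + S₂
  cross = trans (∑-cong xs λ y → square (f x) (f y))
    (trans (∑-+ xs (λ y → f x · f x + (- (f x + f x)) · f y) (λ y → f y · f y))
      (cong (_+ S₂) (trans (∑-+ xs (λ _ → f x · f x) (λ y → (- (f x + f x)) · f y))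
        (cong₂ _+_ (∑-const xs (f x · f x)) (∑-·ˡ xs (- (f x + f x)) f)))))

-- The averaging argument, in a form that computes the witness: if no term reaches `τ`, the weighted
-- sum is too small, which later contradicts the number of walks.
large-term-or-small-∑ : {A : Set} (xs : List A) (f g : A → ℚ) (τ : ℚ) → (∀ x → 0ℚ ≤ℚ f x) →
  (Σ A λ x → τ ≤ℚ g x) ⊎ ∑[ x ← xs ] f x · g x ≤ℚ ∑[ x ← xs ] f x · τ
large-term-or-small-∑ []       f g τ 0≤f = inj₂ ≤-refl
large-term-or-small-∑ (x ∷ xs) f g τ 0≤f with ≤-total τ (g x) | large-term-or-small-∑ xs f g τ 0≤f
... | inj₁ τ≤gx | _          = inj₁ (x , τ≤gx)
... | inj₂ _    | inj₁ large = inj₁ large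
... | inj₂ gx≤τ | inj₂ small = inj₂ (+-mono-≤ (·-monoˡ-≤ (0≤f x) gx≤τ) small)

∑-allVecs-const : ∀ n k a → ∑[ _ ← allVecs n k ] a ≡ ℕ→ℚ n ^ℚ k · a
∑-allVecs-const n zero    a = trans (+-identityʳ a) (sym (*-identityˡ a))
∑-allVecs-const n (suc k) a = begin
  ∑[ _ ← allVecs n (suc k) ] a             ≡⟨ ∑-allVecs-suc n k (λ _ → a) ⟩
  ∑[ _ ← allVecs n k ] ∑[ _ ← allFin n ] a ≡⟨ ∑-allVecs-const n k _ ⟩
  ℕ→ℚ n ^ℚ k · (∑[ _ ← allFin n ] a)       ≡⟨ cong (ℕ→ℚ n ^ℚ k ·_) (∑-allFin-const n a) ⟩
  ℕ→ℚ n ^ℚ k · (ℕ→ℚ n · a)                 ≡⟨ rearrange (ℕ→ℚ n ^ℚ k) (ℕ→ℚ n) a ⟩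
  ℕ→ℚ n ^ℚ suc k · a                       ∎
  where
  open ≡-Reasoning
  rearrange : ∀ p m a → p · (m · a) ≡ m · p · a
  rearrange = solve-∀ ℚ-ring

∑-allVecs-head : ∀ n k g → ∑[ w ← allVecs n (suc k) ] g (head w) ≡ ℕ→ℚ n ^ℚ k · ∑ (allFin n) g
∑-allVecs-head n k g = trans (∑-allVecs-suc n k (λ w → g (head w))) (∑-allVecs-const n k (∑ (allFin n) g))

-- Signs and indicators

indicator : Bool → ℚ
indicator true  = 1ℚ
indicator false = 0ℚ

sign : Bool → ℚ
sign true  = 1ℚ
sign false = - 1ℚ

indicator-nonNeg : ∀ b → 0ℚ ≤ℚ indicator b
indicator-nonNeg true  = 0≤1
indicator-nonNeg false = ≤-refl

indicator≤1 : ∀ b → indicator b ≤ℚ 1ℚ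
indicator≤1 true  = ≤-refl
indicator≤1 false = 0≤1

indicator-∧ : ∀ a b → indicator (a ∧ b) ≡ indicator a · indicator b
indicator-∧ true  b = sym (*-identityˡ (indicator b))
indicator-∧ false b = sym (*-zeroˡ (indicator b))

indicator-∧-≤ʳ : ∀ a b → indicator (a ∧ b) ≤ℚ indicator b
indicator-∧-≤ʳ true  b = ≤-refl
indicator-∧-≤ʳ false b = indicator-nonNeg b

indicator-sign : ∀ b → indicator b ≡ ½ · (1ℚ + sign b)
indicator-sign true  = refl
indicator-sign false = refl

sign-not : ∀ b → sign (not b) ≡ - sign b
sign-not true  = refl
sign-not false = refl

sign-xor : ∀ a b → sign (a xor b) ≡ - (sign a · sign b)
sign-xor true  true  = refl
sign-xor true  false = refl
sign-xor false true  = refl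
sign-xor false false = refl

sign-square : ∀ b → sign b · sign b ≡ 1ℚ
sign-square true  = refl
sign-square false = refl

sign≤1 : ∀ b → sign b ≤ℚ 1ℚ
sign≤1 true  = ≤-refl
sign≤1 false = ≤-trans (neg-antimono-≤ 0≤1) 0≤1

-1≤sign : ∀ b → - 1ℚ ≤ℚ sign b
-1≤sign true  = ≤-trans (neg-antimono-≤ 0≤1) 0≤1
-1≤sign false = ≤-refl

sign-·≤∣∣ : ∀ b p → sign b · p ≤ℚ ∣ p ∣
sign-·≤∣∣ true  p = subst (_≤ℚ ∣ p ∣) (sym (*-identityˡ p)) (p≤∣p∣ p)
sign-·≤∣∣ false p = subst (_≤ℚ ∣ p ∣) (-p≡-1·p p) (-p≤∣p∣ p)
  where
  -p≡-1·p : ∀ p → - p ≡ - 1ℚ · p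
  -p≡-1·p = solve-∀ ℚ-ring

∣sign∣ : ∀ b → ∣ sign b ∣ ≡ 1ℚ
∣sign∣ true  = refl
∣sign∣ false = refl

ℕ→ℚ-count : {A : Set} (p : A → Bool) (xs : List A) → ℕ→ℚ (count p xs) ≡ ∑[ x ← xs ] indicator (p x)
ℕ→ℚ-count p []       = refl
ℕ→ℚ-count p (x ∷ xs) with p x
... | true  = trans (ℕ→ℚ-+ 1 (count p xs)) (cong (1ℚ +_) (ℕ→ℚ-count p xs))
... | false = trans (ℕ→ℚ-count p xs) (sym (+-identityˡ _))

∧-true : ∀ a {b} → a ∧ b ≡ true → a ≡ true × b ≡ true
∧-true true {true} refl = refl , refl

-- AM-GM without roots: (x + y)² - 4 = 4 (x y - 1) + (x - y)².
1≤p·q⇒2≤p+q : ∀ {x y} → 0ℚ ≤ℚ x → 0ℚ ≤ℚ y → 1ℚ ≤ℚ x · y → 2ℚ ≤ℚ x + y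
1≤p·q⇒2≤p+q {x} {y} 0≤x 0≤y 1≤xy = square-cancel-≤ (+-nonNeg 0≤x 0≤y)
  (≤-from-difference (+-nonNeg (·-nonNeg (nonNegative⁻¹ (2ℚ + 2ℚ)) (p≤q⇒0≤q-p 1≤xy)) (square-nonNeg (x - y))) (identity x y))
  where
  identity : ∀ x y → (x + y) · (x + y) - 2ℚ · 2ℚ ≡ (2ℚ + 2ℚ) · (x · y - 1ℚ) + (x - y) · (x - y)
  identity = solve-∀ ℚ-ring

sign-· : ∀ a b → sign a · sign b ≡ sign (not (a xor b))
sign-· true  true  = refl
sign-· true  false = refl
sign-· false true  = refl
sign-· false false = refl

sign-·-·≤1 : ∀ a b c → sign a · sign b · sign c ≤ℚ 1ℚ
sign-·-·≤1 a b c = subst (_≤ℚ 1ℚ) (sym (trans (cong (_· sign c) (sign-· a b)) (sign-· (not (a xor b)) c)))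
  (sign≤1 (not (not (a xor b) xor c)))

-1≤sign-·-· : ∀ a b c → - 1ℚ ≤ℚ sign a · sign b · sign c
-1≤sign-·-· a b c = subst (- 1ℚ ≤ℚ_) (sym (trans (cong (_· sign c) (sign-· a b)) (sign-· (not (a xor b)) c)))
  (-1≤sign (not (not (a xor b) xor c)))

-- A union bound: the defect 1 - p q is at most the sum of the defects 1 - p and 1 - q. Applied to
-- signs and summed over all pairs, it multiplies two approximate identities.
p+q-1≤p·q : ∀ {p q} → p ≤ℚ 1ℚ → q ≤ℚ 1ℚ → p + q - 1ℚ ≤ℚ p · q
p+q-1≤p·q {p} {q} p≤1 q≤1 = ≤-from-difference (·-nonNeg (p≤q⇒0≤q-p p≤1) (p≤q⇒0≤q-p q≤1)) (identity p q)
  where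
  identity : ∀ p q → p · q - (p + q - 1ℚ) ≡ (1ℚ - p) · (1ℚ - q)
  identity = solve-∀ ℚ-ring

ℕ→ℚ-card : ∀ {n} (X : Subset n) → ℕ→ℚ (card X) ≡ ∑[ i ← allFin n ] indicator (lookup X i)
ℕ→ℚ-card []ᵥ = refl
ℕ→ℚ-card {suc n} (b ∷ᵥ X) = begin
  ℕ→ℚ (card (b ∷ᵥ X))                                                      ≡⟨ head-term b ⟩
  indicator b + ℕ→ℚ (card X)                                               ≡⟨ cong (indicator b +_) (ℕ→ℚ-card X) ⟩
  indicator b + (∑[ i ← allFin n ] indicator (lookup X i))                 ≡⟨ cong (indicator b +_) (∑-map Fin.suc (allFin n) _) ⟨
  indicator b + ∑ (map Fin.suc (allFin n)) (λ i → indicator (lookup (b ∷ᵥ X) i)) ≡⟨ cong (λ l → indicator b + ∑ l (λ i → indicator (lookup (b ∷ᵥ X) i))) (List.map-tabulate (λ i → i) Fin.suc) ⟩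
  ∑[ i ← allFin (suc n) ] indicator (lookup (b ∷ᵥ X) i)                    ∎
  where
  open ≡-Reasoning
  head-term : ∀ b → ℕ→ℚ (card (b ∷ᵥ X)) ≡ indicator b + ℕ→ℚ (card X)
  head-term true  = ℕ→ℚ-+ 1 (card X)
  head-term false = sym (+-identityˡ _)

ℕ→ℚ-sum : {A : Set} (f : A → ℕ) (xs : List A) → ℕ→ℚ (sum (map f xs)) ≡ ∑[ x ← xs ] ℕ→ℚ (f x)
ℕ→ℚ-sum f []       = refl
ℕ→ℚ-sum f (x ∷ xs) = trans (ℕ→ℚ-+ (f x) (sum (map f xs))) (cong (ℕ→ℚ (f x) +_) (ℕ→ℚ-sum f xs))

-- The restriction to i < j is dropped. For symmetric `p` this roughly doubles the count, a loss
-- that the constants absorb.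
countPairs≤∑ : ∀ n p → ℕ→ℚ (countPairs n p) ≤ℚ ∑[ i ← allFin n ] ∑[ j ← allFin n ] indicator (p i j)
countPairs≤∑ n p = ≤-trans
  (≤-reflexive (trans (ℕ→ℚ-sum _ (allFin n)) (∑-cong (allFin n) λ i → ℕ→ℚ-count _ (allFin n))))
  (∑-mono-≤ (allFin n) λ i → ∑-mono-≤ (allFin n) λ j → indicator-∧-≤ʳ ⌊ toℕ i ℕ.<? toℕ j ⌋ (p i j))

-- Constants and thresholds

-- The bound κ² ≤ L ε loses enough in the exponent for the constant L to be absorbed.
leRoot32 : ∀ {L ε κ g} x y → 0ℚ ≤ℚ ε → 0ℚ ≤ℚ L → L · ε ≤ℚ 1ℚ → L · L · ε ≤ℚ 1ℚ → 0ℚ ≤ℚ κ → κ · κ ≤ℚ L · ε →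
  x ≤ℚ g → g · g ≤ℚ κ · (y · y) → LeRoot32 ((4 ÷ℕ 1) · ε) x y
leRoot32 {L} {ε} {κ} {g} x y 0≤ε 0≤L Lε≤1 L²ε≤1 0≤κ κ²≤Lε x≤g g²≤κy² with ≤-total x 0ℚ
... | inj₁ x≤0 = inj₁ x≤0
... | inj₂ 0≤x = inj₂ (begin
  x ^ℚ 32                        ≡⟨ ^-double x 16 ⟩
  (x · x) ^ℚ 16                  ≤⟨ ^-mono-≤ 16 (square-nonNeg x) (≤-trans (·-mono-≤ 0≤x 0≤x x≤g x≤g) g²≤κy²) ⟩
  (κ · (y · y)) ^ℚ 16            ≡⟨ ^-distrib-· κ (y · y) 16 ⟩
  κ ^ℚ 16 · (y · y) ^ℚ 16        ≡⟨ cong₂ _·_ (^-double κ 8) (sym (^-double y 16)) ⟩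
  (κ · κ) ^ℚ 8 · y ^ℚ 32         ≤⟨ ·-monoʳ-≤ 0≤y³² (≤-trans (^-mono-≤ 8 (square-nonNeg κ) κ²≤Lε) [Lε]⁸≤4ε) ⟩
  (4 ÷ℕ 1) · ε · y ^ℚ 32         ∎)
  where
  open ≤-Reasoning
  0≤Lε : 0ℚ ≤ℚ L · ε
  0≤Lε = ·-nonNeg 0≤L 0≤ε
  0≤y³² : 0ℚ ≤ℚ y ^ℚ 32
  0≤y³² = subst (0ℚ ≤ℚ_) (sym (^-double y 16)) (^-nonNeg 16 (square-nonNeg y))
  -- Six of the eight factors are at most 1 in total; the other two are L² ε · ε, where L² ε ≤ 1.
  [Lε]⁸≤4ε : (L · ε) ^ℚ 8 ≤ℚ (4 ÷ℕ 1) · ε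
  [Lε]⁸≤4ε = begin
    L · ε · (L · ε · (L · ε) ^ℚ 6)     ≤⟨ ·-monoˡ-≤ 0≤Lε (·-monoˡ-≤ 0≤Lε (^-mono-≤ {q = 1ℚ} 6 0≤Lε Lε≤1)) ⟩
    L · ε · (L · ε · 1ℚ)               ≡⟨ rearrange L ε ⟩
    L · L · ε · ε                      ≤⟨ ·-monoʳ-≤ 0≤ε (≤-trans L²ε≤1 1≤4) ⟩
    (4 ÷ℕ 1) · ε                       ∎
    where
    rearrange : ∀ l e → l · e · (l · e · 1ℚ) ≡ l · l · e · e
    rearrange = solve-∀ ℚ-ring
    1≤4 : 1ℚ ≤ℚ 4 ÷ℕ 1
    1≤4 = ℕ→ℚ-mono-≤ (s≤s {n = 3} z≤n)

private
  gap-identity : ∀ η m f → η · m - (m - f) ≡ m + f - (2ℚ - η) · m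
  gap-identity = solve-∀ ℚ-ring

  collect-identity : ∀ s t e x → s · t + (s · (e + e + e) + x) ≡ s · (t + (e + e + e)) + x
  collect-identity = solve-∀ ℚ-ring

  -- Upper and lower bound for the number of walks are both multiples of N³ h^m, here and in
  -- `lower-identity`. The variables `m`, `h`, `η` stand for N, h^m and 2 - η.
  factor-identity : ∀ m h e p η → (m · h + e · (m · (p · h))) · (η · (m · m) + (e · (m · m) + e · (m · m) + e · (m · m))) + 3ℚ · (m · (p · h) · (e · (m · m)))
    ≡ m · (m · m) · h · ((1ℚ + e · p) · (η + 3ℚ · e) + 3ℚ · (p · e))
  factor-identity = solve-∀ ℚ-ring

  lower-identity : ∀ m h ε → m · (m · m) · h · (2ℚ - 4ℚ · ε) ≡ 8ℚ · ((1ℚ - 2ℚ · ε) · (m · (½ · m · (½ · m · h))))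
  lower-identity = solve-∀ ℚ-ring

  -- The constant 11 in the slope C = 11 p of η makes the right-hand side nonnegative for 0 ≤ e ≤ 1 ≤ p.
  slack-identity : ∀ ε e p → 2ℚ - 4ℚ · ε - ((1ℚ + e · p) · (2ℚ - (4ℚ · ε + 11ℚ · p · e) + 3ℚ · e) + 3ℚ · (p · e))
    ≡ 3ℚ · (e · (p - 1ℚ)) + 3ℚ · (p · e · (1ℚ - e)) + e · p · (4ℚ · ε + 11ℚ · p · e)
  slack-identity = solve-∀ ℚ-ring

halves : ∀ n → ℕ→ℚ ⌊ n /2⌋ + ℕ→ℚ ⌈ n /2⌉ ≡ ℕ→ℚ n
halves n = trans (sym (ℕ→ℚ-+ ⌊ n /2⌋ ⌈ n /2⌉)) (cong ℕ→ℚ (ℕ.⌊n/2⌋+⌈n/2⌉≡n n))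

0≤half-difference : ∀ n → 0ℚ ≤ℚ ½ · (ℕ→ℚ ⌈ n /2⌉ - ℕ→ℚ ⌊ n /2⌋)
0≤half-difference n = ·-nonNeg (nonNegative⁻¹ ½) (p≤q⇒0≤q-p (ℕ→ℚ-mono-≤ (ℕ.⌊n/2⌋≤⌈n/2⌉ n)))

⌊n/2⌋≤½·n : ∀ n → ℕ→ℚ ⌊ n /2⌋ ≤ℚ ½ · ℕ→ℚ n
⌊n/2⌋≤½·n n = ≤-from-difference (0≤half-difference n)
  (trans (cong (λ r → ½ · r - ℕ→ℚ ⌊ n /2⌋) (sym (halves n))) (identity (ℕ→ℚ ⌊ n /2⌋) (ℕ→ℚ ⌈ n /2⌉)))
  where
  identity : ∀ a b → ½ · (a + b) - a ≡ ½ · (b - a)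
  identity = solve-∀ ℚ-ring

½·n≤⌈n/2⌉ : ∀ n → ½ · ℕ→ℚ n ≤ℚ ℕ→ℚ ⌈ n /2⌉
½·n≤⌈n/2⌉ n = ≤-from-difference (0≤half-difference n)
  (trans (cong (λ r → ℕ→ℚ ⌈ n /2⌉ - ½ · r) (sym (halves n))) (identity (ℕ→ℚ ⌊ n /2⌋) (ℕ→ℚ ⌈ n /2⌉)))
  where
  identity : ∀ a b → b - ½ · (a + b) ≡ ½ · (b - a)
  identity = solve-∀ ℚ-ring

N²≤4·choose2 : ∀ n → 2 ≤ n → ℕ→ℚ n · ℕ→ℚ n ≤ℚ 4ℚ · choose2 n
N²≤4·choose2 n 2≤n = ≤-from-difference (·-nonNeg (ℕ→ℚ-nonNeg n) (p≤q⇒0≤q-p (ℕ→ℚ-mono-≤ 2≤n))) (begin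
  4ℚ · choose2 n - N · N                      ≡⟨ double (choose2 n) N ⟩
  2ℚ · (2ℚ · choose2 n) - N · N               ≡⟨ cong (λ r → 2ℚ · r - N · N) (a/[1+d]·[1+d]≡a (n * (n ∸ 1)) 1) ⟩
  2ℚ · ℕ→ℚ (n * (n ∸ 1)) - N · N              ≡⟨ cong (λ r → 2ℚ · r - N · N) (trans (ℕ→ℚ-* n (n ∸ 1)) (cong (N ·_) (ℕ→ℚ-∸ (ℕ.≤-trans (s≤s {n = 1} z≤n) 2≤n)))) ⟩
  2ℚ · (N · (N - 1ℚ)) - N · N                 ≡⟨ identity N ⟩
  N · (N - 2ℚ)                                ∎)
  where
  open ≡-Reasoning
  N : ℚ
  N = ℕ→ℚ n
  double : ∀ q m → 4ℚ · q - m · m ≡ 2ℚ · (2ℚ · q) - m · m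
  double = solve-∀ ℚ-ring
  identity : ∀ m → 2ℚ · (m · (m - 1ℚ)) - m · m ≡ m · (m - 2ℚ)
  identity = solve-∀ ℚ-ring

-- C is the slope of η in e; then η² ≤ C₁ ε, and L bounds the constants of both parts of δ-bipartiteness.
C₁ L : ℕ → ℚ
C₁ m = ℕ→ℚ 32 + ℕ→ℚ 8 · ((11ℚ · 2ℚ ^ℚ m) · (11ℚ · 2ℚ ^ℚ m))
L m  = (36ℚ · C₁ m) · (36ℚ · C₁ m)

1≤C₁ : ∀ m → 1ℚ ≤ℚ C₁ m
1≤C₁ m = +-mono-≤ {1ℚ} {ℕ→ℚ 32} {0ℚ} (ℕ→ℚ-mono-≤ (s≤s {n = 31} z≤n)) (·-nonNeg (ℕ→ℚ-nonNeg 8) (square-nonNeg (11ℚ · 2ℚ ^ℚ m)))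

36≤36·C₁ : ∀ m → 36ℚ ≤ℚ 36ℚ · C₁ m
36≤36·C₁ m = subst (_≤ℚ 36ℚ · C₁ m) (*-identityʳ 36ℚ) (·-monoˡ-≤ (ℕ→ℚ-nonNeg 36) (1≤C₁ m))

36≤L : ∀ m → 36ℚ ≤ℚ L m
36≤L m = ≤-trans (ℕ→ℚ-mono-≤ {36} {36 * 36} (ℕ.m≤m*n 36 36)) (·-mono-≤ (ℕ→ℚ-nonNeg 36) (ℕ→ℚ-nonNeg 36) (36≤36·C₁ m) (36≤36·C₁ m))

-- Weighted counts of alternating walks

module Coloured {n : ℕ} (c : Colouring n) (c-sym : ∀ i j → c i j ≡ c j i) (0<n : 0ℚ < ℕ→ℚ n) where

  V : List (Fin n)
  V = allFin n

  N h : ℚ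
  N = ℕ→ℚ n
  h = ½ · N

  0≤N : 0ℚ ≤ℚ N
  0≤N = <⇒≤ 0<n

  0≤h : 0ℚ ≤ℚ h
  0≤h = ·-nonNeg (nonNegative⁻¹ ½) 0≤N

  0<h : 0ℚ < h
  0<h = ·-pos (positive⁻¹ ½) 0<n

  s : Fin n → Fin n → ℚ
  s i j = sign (c i j)

  -- D i is the red degree minus the blue degree.
  D : Fin n → ℚ
  D i = ∑[ j ← V ] s i j

  edge : Bool → Fin n → Fin n → ℚ
  edge b i j = indicator (not (c i j xor b))

  degree : Bool → Fin n → ℚ
  degree b i = ∑ V (edge b i)

  s-sym : ∀ i j → s i j ≡ s j i
  s-sym i j = cong sign (c-sym i j)

  edge-sym : ∀ b i j → edge b i j ≡ edge b j i
  edge-sym b i j = cong (λ r → indicator (not (r xor b))) (c-sym i j)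

  edge-nonNeg : ∀ b i j → 0ℚ ≤ℚ edge b i j
  edge-nonNeg b i j = indicator-nonNeg (not (c i j xor b))

  edge≤1 : ∀ b i j → edge b i j ≤ℚ 1ℚ
  edge≤1 b i j = indicator≤1 (not (c i j xor b))

  edge-s : ∀ b i j → edge b i j ≡ ½ · (1ℚ + sign b · s i j)
  edge-s b i j with c i j | b
  ... | true  | true  = refl
  ... | true  | false = refl
  ... | false | true  = refl
  ... | false | false = refl

  ∣∑-sign∣≤N : (b : Fin n → Bool) → ∣ ∑[ i ← V ] sign (b i) ∣ ≤ℚ N
  ∣∑-sign∣≤N b = ≤-trans (∣∑∣≤∑∣∣ V (λ i → sign (b i)))
    (≤-reflexive (trans (∑-cong V (λ i → ∣sign∣ (b i))) (trans (∑-allFin-const n 1ℚ) (*-identityʳ N))))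

  degree-D : ∀ b i → degree b i ≡ ½ · (N + sign b · D i)
  degree-D b i = begin
    ∑[ j ← V ] edge b i j                                   ≡⟨ ∑-cong V (edge-s b i) ⟩
    ∑[ j ← V ] ½ · (1ℚ + sign b · s i j)                    ≡⟨ ∑-·ˡ V ½ _ ⟩
    ½ · (∑[ j ← V ] (1ℚ + sign b · s i j))                  ≡⟨ cong (½ ·_) (∑-+ V _ _) ⟩
    ½ · ((∑[ j ← V ] 1ℚ) + (∑[ j ← V ] sign b · s i j))     ≡⟨ cong (½ ·_) (cong₂ _+_ (trans (∑-allFin-const n 1ℚ) (*-identityʳ N)) (∑-·ˡ V (sign b) (s i))) ⟩
    ½ · (N + sign b · D i)                                  ∎
    where open ≡-Reasoning

  degree-nonNeg : ∀ b i → 0ℚ ≤ℚ degree b i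
  degree-nonNeg b i = ∑-nonNeg V (edge-nonNeg b i)

  edge⇒degree-pos : ∀ b i j → edge b i j ≡ 1ℚ → 0ℚ < degree b i
  edge⇒degree-pos b i j e≡1 = <-≤-trans (positive⁻¹ 1ℚ)
    (subst (_≤ℚ degree b i) e≡1 (term≤∑ (edge-nonNeg b i) (∈-allFin j)))

  -- The transition probability scaled by h, so that a step weighs 1 in a perfectly balanced
  -- colouring and the powers of h come out of the sums.
  step : Bool → Fin n → ℚ
  step b i = h · inv (degree b i)

  step-nonNeg : ∀ b i → 0ℚ ≤ℚ step b i
  step-nonNeg b i = ·-nonNeg 0≤h (inv-nonNeg (degree-nonNeg b i))

  step·degree≤h : ∀ b i → step b i · degree b i ≤ℚ h
  step·degree≤h b i = subst₂ _≤ℚ_ (rearrange h (inv (degree b i)) (degree b i)) (*-identityʳ h)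
    (·-monoˡ-≤ 0≤h (p·inv≤1 (degree b i)))
    where
    rearrange : ∀ h i d → h · (d · i) ≡ h · i · d
    rearrange = solve-∀ ℚ-ring

  -- The ratio of 4 d_R(i) d_B(i) to n².
  balance : Fin n → ℚ
  balance i = 1ℚ - D i · inv N · (D i · inv N)

  balance≤1 : ∀ i → balance i ≤ℚ 1ℚ
  balance≤1 i = ≤-from-difference (square-nonNeg (D i · inv N)) (identity (D i · inv N))
    where
    identity : ∀ p → 1ℚ - (1ℚ - p · p) ≡ p · p
    identity = solve-∀ ℚ-ring

  balance·h² : ∀ b i → balance i · (h · h) ≡ degree b i · degree (not b) i
  balance·h² b i = begin
    balance i · (h · h)                                               ≡⟨ lhs (D i) (inv N) N ⟩
    (½ · ½) · (N · N - (N · inv N) · (N · inv N) · (D i · D i))       ≡⟨ cong (λ r → (½ · ½) · (N · N - r · r · (D i · D i))) (inv-inverse 0<n) ⟩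
    (½ · ½) · (N · N - 1ℚ · 1ℚ · (D i · D i))                         ≡⟨ cong (λ r → (½ · ½) · (N · N - r · (D i · D i))) (sym (sign-square b)) ⟩
    (½ · ½) · (N · N - sign b · sign b · (D i · D i))                 ≡⟨ rhs (D i) (sign b) N ⟩
    ½ · (N + sign b · D i) · (½ · (N + - sign b · D i))               ≡⟨ cong (λ r → ½ · (N + sign b · D i) · (½ · (N + r · D i))) (sym (sign-not b)) ⟩
    ½ · (N + sign b · D i) · (½ · (N + sign (not b) · D i))           ≡⟨ cong₂ _·_ (sym (degree-D b i)) (sym (degree-D (not b) i)) ⟩
    degree b i · degree (not b) i                                     ∎
    where
    open ≡-Reasoning
    lhs : ∀ d t m → (1ℚ - d · t · (d · t)) · (½ · m · (½ · m)) ≡ (½ · ½) · (m · m - (m · t) · (m · t) · (d · d))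
    lhs = solve-∀ ℚ-ring
    rhs : ∀ d b m → (½ · ½) · (m · m - b · b · (d · d)) ≡ ½ · (m + b · d) · (½ · (m + - b · d))
    rhs = solve-∀ ℚ-ring

  balance-nonNeg : ∀ i → 0ℚ ≤ℚ balance i
  balance-nonNeg i = ·-cancelˡ-≤ (·-pos 0<h 0<h)
    (subst₂ _≤ℚ_ (sym (*-zeroʳ (h · h))) (trans (sym (balance·h² true i)) (*-comm (balance i) (h · h)))
      (·-nonNeg (degree-nonNeg true i) (degree-nonNeg false i)))

  balance·step·step≡1 : ∀ b i → 0ℚ < degree b i → 0ℚ < degree (not b) i → balance i · (step b i · step (not b) i) ≡ 1ℚ
  balance·step·step≡1 b i 0<d 0<d′ = begin
    balance i · (h · inv d · (h · inv d′))      ≡⟨ rearrange (balance i) h (inv d) (inv d′) ⟩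
    balance i · (h · h) · (inv d · inv d′)      ≡⟨ cong (_· (inv d · inv d′)) (balance·h² b i) ⟩
    d · d′ · (inv d · inv d′)                   ≡⟨ ·-interchange d d′ (inv d) (inv d′) ⟩
    d · inv d · (d′ · inv d′)                   ≡⟨ cong₂ _·_ (inv-inverse 0<d) (inv-inverse 0<d′) ⟩
    1ℚ                                          ∎
    where
    open ≡-Reasoning
    d d′ : ℚ
    d  = degree b i
    d′ = degree (not b) i
    rearrange : ∀ q h i j → q · (h · i · (h · j)) ≡ q · (h · h) · (i · j)
    rearrange = solve-∀ ℚ-ring

  -- The two degrees at `i` add up to n, so their product is at most h².
  1≤step·step : ∀ b i → 0ℚ < degree b i → 0ℚ < degree (not b) i → 1ℚ ≤ℚ step b i · step (not b) i
  1≤step·step b i 0<d 0<d′ = subst₂ _≤ℚ_ (balance·step·step≡1 b i 0<d 0<d′) (*-identityˡ (step b i · step (not b) i))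
    (·-monoʳ-≤ (·-nonNeg (step-nonNeg b i) (step-nonNeg (not b) i)) (balance≤1 i))

  -- Up to powers of h, the probabilities of the alternating random walk that runs
  -- through w and then to v, and of the one that runs through w backwards.
  forward : ∀ {k} → Bool → Fin n → Vec (Fin n) (suc k) → ℚ
  forward {zero}  b v (x ∷ᵥ _) = edge b x v · step b x
  forward {suc k} b v (x ∷ᵥ w) = edge b x (head w) · step b x · forward (not b) v w

  backward : ∀ {k} → Bool → Vec (Fin n) (suc k) → ℚ
  backward {zero}  b _        = 1ℚ
  backward {suc k} b (x ∷ᵥ w) = edge b x (head w) · step b (head w) · backward (not b) w

  forward-nonNeg : ∀ {k} b v (w : Vec (Fin n) (suc k)) → 0ℚ ≤ℚ forward b v w
  forward-nonNeg {zero}  b v (x ∷ᵥ _) = ·-nonNeg (edge-nonNeg b x v) (step-nonNeg b x)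
  forward-nonNeg {suc k} b v (x ∷ᵥ w) = ·-nonNeg (·-nonNeg (edge-nonNeg b x (head w)) (step-nonNeg b x)) (forward-nonNeg (not b) v w)

  backward-nonNeg : ∀ {k} b (w : Vec (Fin n) (suc k)) → 0ℚ ≤ℚ backward b w
  backward-nonNeg {zero}  b w        = 0≤1
  backward-nonNeg {suc k} b (x ∷ᵥ w) = ·-nonNeg (·-nonNeg (edge-nonNeg b x (head w)) (step-nonNeg b (head w))) (backward-nonNeg (not b) w)

  ∑-step : ∀ b i → ∑[ j ← V ] edge b i j · step b i ≤ℚ h
  ∑-step b i = subst (_≤ℚ h) (trans (*-comm (step b i) (degree b i)) (sym (∑-·ʳ V (step b i) (edge b i)))) (step·degree≤h b i)

  -- The weight `g` is arbitrary for the sake of the induction: summing out the first vertex pushes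
  -- `g` one step along the walk to `g′`, whose total is at most h times that of `g`.
  ∑-forward : ∀ k b (g : Fin n → ℚ) → (∀ x → 0ℚ ≤ℚ g x) →
    ∑[ w ← allVecs n (suc k) ] ∑[ v ← V ] g (head w) · forward b v w ≤ℚ h ^ℚ suc k · ∑ V g
  ∑-forward zero b g 0≤g = begin
    ∑[ w ← allVecs n 1 ] ∑[ v ← V ] g (head w) · forward b v w      ≡⟨ ∑-allVecs-suc n 0 (λ w → ∑[ v ← V ] g (head w) · forward b v w) ⟩
    (∑[ x ← V ] ∑[ v ← V ] g x · (edge b x v · step b x)) + 0ℚ      ≡⟨ +-identityʳ _ ⟩
    ∑[ x ← V ] ∑[ v ← V ] g x · (edge b x v · step b x)             ≡⟨ ∑-cong V (λ x → ∑-·ˡ V (g x) _) ⟩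
    ∑[ x ← V ] g x · (∑[ v ← V ] edge b x v · step b x)             ≤⟨ ∑-mono-≤ V (λ x → ·-monoˡ-≤ (0≤g x) (∑-step b x)) ⟩
    ∑[ x ← V ] g x · h                                              ≡⟨ ∑-·ʳ V h g ⟩
    ∑ V g · h                                                       ≡⟨ *-comm (∑ V g) h ⟩
    h · ∑ V g                                                       ≡⟨ cong (_· ∑ V g) (*-identityʳ h) ⟨
    h ^ℚ 1 · ∑ V g                                                  ∎
    where open ≤-Reasoning
  ∑-forward (suc k) b g 0≤g = begin
    ∑[ w ← allVecs n (suc (suc k)) ] ∑[ v ← V ] g (head w) · forward b v w
      ≡⟨ ∑-allVecs-suc n (suc k) (λ w → ∑[ v ← V ] g (head w) · forward b v w) ⟩
    ∑[ w ← allVecs n (suc k) ] ∑[ x ← V ] ∑[ v ← V ] g x · (edge b x (head w) · step b x · forward (not b) v w)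
      ≡⟨ ∑-cong (allVecs n (suc k)) (λ w → ∑-comm V V _) ⟩
    ∑[ w ← allVecs n (suc k) ] ∑[ v ← V ] ∑[ x ← V ] g x · (edge b x (head w) · step b x · forward (not b) v w)
      ≡⟨ ∑-cong (allVecs n (suc k)) (λ w → ∑-cong V λ v →
           trans (∑-cong V (λ x → sym (*-assoc (g x) (edge b x (head w) · step b x) (forward (not b) v w))))
                 (∑-·ʳ V (forward (not b) v w) _)) ⟩
    ∑[ w ← allVecs n (suc k) ] ∑[ v ← V ] g′ (head w) · forward (not b) v w
      ≤⟨ ∑-forward k (not b) g′ (λ y → ∑-nonNeg V λ x → ·-nonNeg (0≤g x) (·-nonNeg (edge-nonNeg b x y) (step-nonNeg b x))) ⟩
    h ^ℚ suc k · ∑ V g′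
      ≡⟨ cong (h ^ℚ suc k ·_) (trans (∑-comm V V _) (∑-cong V λ x → ∑-·ˡ V (g x) _)) ⟩
    h ^ℚ suc k · (∑[ x ← V ] g x · (∑[ y ← V ] edge b x y · step b x))
      ≤⟨ ·-monoˡ-≤ (^-nonNeg (suc k) 0≤h) (∑-mono-≤ V (λ x → ·-monoˡ-≤ (0≤g x) (∑-step b x))) ⟩
    h ^ℚ suc k · (∑[ x ← V ] g x · h)
      ≡⟨ trans (cong (h ^ℚ suc k ·_) (∑-·ʳ V h g)) (rearrange (h ^ℚ suc k) (∑ V g) h) ⟩
    h ^ℚ suc (suc k) · ∑ V g
      ∎
    where
    open ≤-Reasoning
    g′ : Fin n → ℚ
    g′ y = ∑[ x ← V ] g x · (edge b x y · step b x)
    rearrange : ∀ a g h → a · (g · h) ≡ h · a · g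
    rearrange = solve-∀ ℚ-ring

  -- The head of the vector is where the backward walk ends, so it can be summed out directly, at
  -- the price of a factor h.
  ∑-backward : ∀ k b → ∑[ w ← allVecs n (suc k) ] backward b w ≤ℚ h ^ℚ k · N
  ∑-backward zero b = ≤-reflexive (begin
    ∑[ w ← allVecs n 1 ] backward b w    ≡⟨ ∑-allVecs-suc n 0 (backward b) ⟩
    (∑[ _ ← V ] 1ℚ) + 0ℚ                 ≡⟨ +-identityʳ _ ⟩
    ∑[ _ ← V ] 1ℚ                        ≡⟨ ∑-allFin-const n 1ℚ ⟩
    N · 1ℚ                               ≡⟨ *-comm N 1ℚ ⟩
    1ℚ · N                               ∎)
    where open ≡-Reasoning
  ∑-backward (suc k) b = begin
    ∑[ w ← allVecs n (suc (suc k)) ] backward b w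
      ≡⟨ ∑-allVecs-suc n (suc k) (backward b) ⟩
    ∑[ w ← allVecs n (suc k) ] ∑[ x ← V ] edge b x (head w) · step b (head w) · backward (not b) w
      ≡⟨ ∑-cong (allVecs n (suc k)) (λ w → trans (∑-·ʳ V (backward (not b) w) _)
           (cong (_· backward (not b) w) (∑-cong V λ x → cong (_· step b (head w)) (edge-sym b x (head w))))) ⟩
    ∑[ w ← allVecs n (suc k) ] (∑[ x ← V ] edge b (head w) x · step b (head w)) · backward (not b) w
      ≤⟨ ∑-mono-≤ (allVecs n (suc k)) (λ w → ·-monoʳ-≤ (backward-nonNeg (not b) w) (∑-step b (head w))) ⟩
    ∑[ w ← allVecs n (suc k) ] h · backward (not b) w
      ≡⟨ ∑-·ˡ (allVecs n (suc k)) h (backward (not b)) ⟩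
    h · (∑[ w ← allVecs n (suc k) ] backward (not b) w)
      ≤⟨ ·-monoˡ-≤ 0≤h (∑-backward k (not b)) ⟩
    h · (h ^ℚ k · N)
      ≡⟨ *-assoc h (h ^ℚ k) N ⟨
    h ^ℚ suc k · N
      ∎
    where open ≤-Reasoning

  module _ {u x y : Fin n} {b : Bool} (ux≡1 : edge (not b) u x ≡ 1ℚ) (xy≡1 : edge b x y ≡ 1ℚ) where

    0<degree : 0ℚ < degree b x
    0<degree = edge⇒degree-pos b x y xy≡1

    0<degree′ : 0ℚ < degree (not b) x
    0<degree′ = edge⇒degree-pos (not b) x u (trans (edge-sym (not b) x u) ux≡1)

  -- The two walks together leave each vertex of `w` once in each colour. Grouped by vertices, the
  -- product consists of factors bounded by `1≤step·step`.
  1≤forward·backward : ∀ {k} b u v (w : Vec (Fin n) (suc k)) → edge (not b) u (head w) ≡ 1ℚ →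
    altWalk c b v (toList w) ≡ true → 1ℚ ≤ℚ forward b v w · backward (not b) (u ∷ᵥ w)
  1≤forward·backward {zero} b u v (x ∷ᵥ []ᵥ) ux≡1 walk =
    subst (1ℚ ≤ℚ_) (trans (pad (step b x) (step (not b) x)) (cong₂ (λ p q → p · step b x · (q · step (not b) x · 1ℚ)) (sym xv≡1) (sym ux≡1)))
      (1≤step·step b x (0<degree ux≡1 xv≡1) (0<degree′ ux≡1 xv≡1))
    where
    xv≡1 : edge b x v ≡ 1ℚ
    xv≡1 = cong indicator walk
    pad : ∀ p q → p · q ≡ 1ℚ · p · (1ℚ · q · 1ℚ)
    pad = solve-∀ ℚ-ring
  1≤forward·backward {suc k} b u v (x ∷ᵥ w@(y ∷ᵥ r)) ux≡1 walk =
    subst (1ℚ ≤ℚ_)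
      (trans (rearrange (step b x) (step (not b) x) (forward (not b) v w) (backward (not (not b)) (x ∷ᵥ w)))
        (cong₂ (λ p q → p · step b x · forward (not b) v w · (q · step (not b) x · backward (not (not b)) (x ∷ᵥ w))) (sym xy≡1) (sym ux≡1)))
      (·-mono-≤ 0≤1 0≤1 (1≤step·step b x (0<degree ux≡1 xy≡1) (0<degree′ ux≡1 xy≡1))
        (1≤forward·backward (not b) x v w (subst (λ b → edge b x y ≡ 1ℚ) (sym (Bool.not-involutive b)) xy≡1) (proj₂ (∧-true (not (c x y xor b)) walk))))
    where
    xy≡1 : edge b x y ≡ 1ℚ
    xy≡1 = cong indicator (proj₁ (∧-true (not (c x y xor b)) walk))
    rearrange : ∀ p q f g → p · q · (f · g) ≡ 1ℚ · p · f · (1ℚ · q · g)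
    rearrange = solve-∀ ℚ-ring

  -- At the head of `w`, `balance` cancels the two steps exactly, so the estimate survives this
  -- extra factor; the tail is covered by `1≤forward·backward`.
  1≤balance·forward·backward : ∀ {k} b u v (w : Vec (Fin n) (suc (suc k))) → edge (not b) u (head w) ≡ 1ℚ →
    altWalk c b v (toList w) ≡ true → 1ℚ ≤ℚ balance (head w) · forward b v w · backward (not b) (u ∷ᵥ w)
  1≤balance·forward·backward b u v (x ∷ᵥ w@(y ∷ᵥ r)) ux≡1 walk =
    subst (1ℚ ≤ℚ_)
      (trans (cong (_· (f · g)) (sym (balance·step·step≡1 b x (0<degree ux≡1 xy≡1) (0<degree′ ux≡1 xy≡1))))
        (trans (rearrange (balance x) (step b x) (step (not b) x) f g)
          (cong₂ (λ p q → balance x · (p · step b x · f) · (q · step (not b) x · g)) (sym xy≡1) (sym ux≡1))))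
      (subst (1ℚ ≤ℚ_) (sym (*-identityˡ (f · g)))
        (1≤forward·backward (not b) x v w (subst (λ b → edge b x y ≡ 1ℚ) (sym (Bool.not-involutive b)) xy≡1) (proj₂ (∧-true (not (c x y xor b)) walk))))
    where
    f g : ℚ
    f = forward (not b) v w
    g = backward (not (not b)) (x ∷ᵥ w)
    xy≡1 : edge b x y ≡ 1ℚ
    xy≡1 = cong indicator (proj₁ (∧-true (not (c x y xor b)) walk))
    rearrange : ∀ a p q f g → a · (p · q) · (f · g) ≡ a · (1ℚ · p · f) · (1ℚ · q · g)
    rearrange = solve-∀ ℚ-ring

  ∑-altWalk : ℕ → ℚ
  ∑-altWalk k = ∑[ w ← allVecs n k ] ∑[ u ← V ] indicator (altWalk c true u (toList (u ∷ᵥ w)))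

  ℕ→ℚ-rooted≤ : ∀ k → ℕ→ℚ (count (isRootedAlt c) (allVecs n (suc k))) ≤ℚ ∑-altWalk k
  ℕ→ℚ-rooted≤ k = begin
    ℕ→ℚ (count (isRootedAlt c) (allVecs n (suc k)))
      ≡⟨ ℕ→ℚ-count (isRootedAlt c) (allVecs n (suc k)) ⟩
    ∑[ w ← allVecs n (suc k) ] indicator (isRootedAlt c w)
      ≡⟨ ∑-allVecs-suc n k (λ w → indicator (isRootedAlt c w)) ⟩
    ∑[ w ← allVecs n k ] ∑[ u ← V ] indicator (isRootedAlt c (u ∷ᵥ w))
      ≤⟨ ∑-mono-≤ (allVecs n k) (λ w → ∑-mono-≤ V λ u → indicator-∧-≤ʳ (allDistinct (toList (u ∷ᵥ w))) _) ⟩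
    ∑-altWalk k
      ∎
    where open ≤-Reasoning

  -- On a closed alternating walk the two summands have product at least 1. The root `u` is only an
  -- end of both random walks and contributes no step.
  altWalk-AM-GM : ∀ {k} u (w : Vec (Fin n) (suc (suc k))) →
    2ℚ · indicator (altWalk c true u (toList (u ∷ᵥ w))) ≤ℚ balance (head w) · forward false u w + backward true (u ∷ᵥ w)
  altWalk-AM-GM u w@(x ∷ᵥ _) with altWalk c true u (toList (u ∷ᵥ w)) in walk
  ... | true  = 1≤p·q⇒2≤p+q (·-nonNeg (balance-nonNeg x) (forward-nonNeg false u w)) (backward-nonNeg true (u ∷ᵥ w))
    (1≤balance·forward·backward false u u w (cong indicator (proj₁ (∧-true (not (c u x xor true)) walk))) (proj₂ (∧-true (not (c u x xor true)) walk)))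
  ... | false = +-nonNeg (·-nonNeg (balance-nonNeg x) (forward-nonNeg false u w)) (backward-nonNeg true (u ∷ᵥ w))

  ∑-altWalk≤ : ∀ k → 2ℚ · ∑-altWalk (suc (suc k)) ≤ℚ h ^ℚ suc (suc k) · (∑ V balance + N)
  ∑-altWalk≤ k = begin
    2ℚ · ∑-altWalk (suc (suc k))
      ≡⟨ trans (sym (∑-·ˡ W 2ℚ _)) (∑-cong W λ w → sym (∑-·ˡ V 2ℚ _)) ⟩
    ∑[ w ← W ] ∑[ u ← V ] 2ℚ · indicator (altWalk c true u (toList (u ∷ᵥ w)))
      ≤⟨ ∑-mono-≤ W (λ w → ∑-mono-≤ V λ u → altWalk-AM-GM u w) ⟩
    ∑[ w ← W ] ∑[ u ← V ] (balance (head w) · forward false u w + backward true (u ∷ᵥ w))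
      ≡⟨ trans (∑-cong W λ w → ∑-+ V _ _) (∑-+ W _ _) ⟩
    (∑[ w ← W ] ∑[ u ← V ] balance (head w) · forward false u w) + (∑[ w ← W ] ∑[ u ← V ] backward true (u ∷ᵥ w))
      ≡⟨ cong ((∑[ w ← W ] ∑[ u ← V ] balance (head w) · forward false u w) +_) (sym (∑-allVecs-suc n (suc (suc k)) (backward true))) ⟩
    (∑[ w ← W ] ∑[ u ← V ] balance (head w) · forward false u w) + ∑ (allVecs n (suc (suc (suc k)))) (backward true)
      ≤⟨ +-mono-≤ (∑-forward (suc k) false balance balance-nonNeg) (∑-backward (suc (suc k)) true) ⟩
    h ^ℚ suc (suc k) · ∑ V balance + h ^ℚ suc (suc k) · N
      ≡⟨ *-distribˡ-+ (h ^ℚ suc (suc k)) (∑ V balance) N ⟨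
    h ^ℚ suc (suc k) · (∑ V balance + N)
      ∎
    where
    open ≤-Reasoning
    W : List (Vec (Fin n) (suc (suc k)))
    W = allVecs n (suc (suc k))

  -- Alternating paths and the pairs that close them

  E : ℚ
  E = ∑[ i ← V ] ∣ D i ∣

  E-nonNeg : 0ℚ ≤ℚ E
  E-nonNeg = ∑-nonNeg V (λ i → 0≤∣p∣ (D i))

  path : ∀ {k} → Bool → Vec (Fin n) (suc k) → ℚ
  path {zero}  b _        = 1ℚ
  path {suc k} b (x ∷ᵥ w) = edge b x (head w) · path (not b) w

  -- Whether the edge from the last vertex of w to v continues the alternation of a walk
  -- along w whose first edge has colour b.
  closes : ∀ {k} → Bool → Fin n → Vec (Fin n) (suc k) → Bool
  closes {zero}  b v (x ∷ᵥ _) = not (c x v xor b)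
  closes {suc k} b v (_ ∷ᵥ w) = closes (not b) v w

  path-nonNeg : ∀ {k} b (w : Vec (Fin n) (suc k)) → 0ℚ ≤ℚ path b w
  path-nonNeg {zero}  b w        = 0≤1
  path-nonNeg {suc k} b (x ∷ᵥ w) = ·-nonNeg (edge-nonNeg b x (head w)) (path-nonNeg (not b) w)

  path≤1 : ∀ {k} b (w : Vec (Fin n) (suc k)) → path b w ≤ℚ 1ℚ
  path≤1 {zero}  b w        = ≤-refl
  path≤1 {suc k} b (x ∷ᵥ w) = ·-mono-≤ {q = 1ℚ} {s = 1ℚ} (edge-nonNeg b x (head w)) (path-nonNeg (not b) w) (edge≤1 b x (head w)) (path≤1 (not b) w)

  altWalk-path : ∀ {k} b v (w : Vec (Fin n) (suc k)) → indicator (altWalk c b v (toList w)) ≡ path b w · indicator (closes b v w)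
  altWalk-path {zero}  b v (x ∷ᵥ []ᵥ)         = sym (*-identityˡ _)
  altWalk-path {suc k} b v (x ∷ᵥ w@(y ∷ᵥ _)) =
    trans (indicator-∧ (not (c x y xor b)) (altWalk c (not b) v (toList w)))
      (trans (cong (edge b x y ·_) (altWalk-path (not b) v w)) (sym (*-assoc (edge b x y) (path (not b) w) _)))

  sign-edge : ∀ b i j → sign (not (c i j xor b)) ≡ sign b · s i j
  sign-edge b i j with c i j | b
  ... | true  | true  = refl
  ... | true  | false = refl
  ... | false | true  = refl
  ... | false | false = refl

  ∣sign·p∣ : ∀ b p → ∣ sign b · p ∣ ≡ ∣ p ∣
  ∣sign·p∣ b p = trans (∣p*q∣≡∣p∣*∣q∣ (sign b) p) (trans (cong (_· ∣ p ∣) (∣sign∣ b)) (*-identityˡ ∣ p ∣))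

  ∣∑-sign-edge∣ : ∀ b i → ∣ ∑[ j ← V ] sign (not (c i j xor b)) ∣ ≡ ∣ D i ∣
  ∣∑-sign-edge∣ b i = trans (cong ∣_∣ (trans (∑-cong V (sign-edge b i)) (∑-·ˡ V (sign b) (s i)))) (∣sign·p∣ b (D i))

  ∣∑-closes∣ : ∀ {k} → Bool → Vec (Fin n) (suc k) → ℚ
  ∣∑-closes∣ b w = ∣ ∑[ v ← V ] sign (closes b v w) ∣

  -- Only the last vertex of the vector matters; each value of it occurs N^k times and contributes
  -- its |D|.
  ∑-∣∑-closes∣ : ∀ k b → ∑ (allVecs n (suc k)) (∣∑-closes∣ b) ≡ N ^ℚ k · E
  ∑-∣∑-closes∣ zero b = begin
    ∑ (allVecs n 1) (∣∑-closes∣ b)                                        ≡⟨ ∑-allVecs-suc n 0 (∣∑-closes∣ b) ⟩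
    (∑[ x ← V ] ∣ ∑[ v ← V ] sign (not (c x v xor b)) ∣) + 0ℚ    ≡⟨ +-identityʳ _ ⟩
    ∑[ x ← V ] ∣ ∑[ v ← V ] sign (not (c x v xor b)) ∣           ≡⟨ ∑-cong V (∣∑-sign-edge∣ b) ⟩
    E                                                            ≡⟨ *-identityˡ E ⟨
    1ℚ · E                                                       ∎
    where open ≡-Reasoning
  ∑-∣∑-closes∣ (suc k) b = begin
    ∑ (allVecs n (suc (suc k))) (∣∑-closes∣ b)                            ≡⟨ ∑-allVecs-suc n (suc k) (∣∑-closes∣ b) ⟩
    ∑[ w ← allVecs n (suc k) ] ∑[ _ ← V ] ∣∑-closes∣ (not b) w   ≡⟨ ∑-cong (allVecs n (suc k)) (λ w → ∑-allFin-const n (∣∑-closes∣ (not b) w)) ⟩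
    ∑[ w ← allVecs n (suc k) ] N · ∣∑-closes∣ (not b) w          ≡⟨ ∑-·ˡ (allVecs n (suc k)) N (∣∑-closes∣ (not b)) ⟩
    N · ∑ (allVecs n (suc k)) (∣∑-closes∣ (not b))               ≡⟨ cong (N ·_) (∑-∣∑-closes∣ k (not b)) ⟩
    N · (N ^ℚ k · E)                                             ≡⟨ *-assoc N (N ^ℚ k) E ⟨
    N ^ℚ suc k · E                                               ∎
    where open ≡-Reasoning

  degree≤ : ∀ b i → degree b i ≤ℚ h + ½ · ∣ D i ∣
  degree≤ b i = subst₂ _≤ℚ_ (sym (degree-D b i)) (*-distribˡ-+ ½ N ∣ D i ∣)
    (·-monoˡ-≤ (nonNegative⁻¹ ½) (+-monoʳ-≤ N (sign-·≤∣∣ b (D i))))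

  -- One more vertex multiplies the old error by h = N/2 and adds a new one of ½ E N^k. These are
  -- two halves of the next error term, so its coefficient stays `e` at every length.
  ∑-path≤ : ∀ {e} → E ≤ℚ e · (N · N) → 0ℚ ≤ℚ e → ∀ k b → ∑ (allVecs n (suc k)) (path b) ≤ℚ N · h ^ℚ k + e · N ^ℚ suc k
  ∑-path≤ {e} E≤ 0≤e zero b = ≤-from-difference {d = e · N ^ℚ 1} (·-nonNeg 0≤e (^-nonNeg 1 0≤N))
    (trans (cong (λ p → N · 1ℚ + e · N ^ℚ 1 - p) (trans (∑-allVecs-const n 1 1ℚ) (rearrange N))) (cancel (N · 1ℚ) (e · N ^ℚ 1)))
    where
    rearrange : ∀ m → m · 1ℚ · 1ℚ ≡ m · 1ℚ
    rearrange = solve-∀ ℚ-ring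
    cancel : ∀ p q → p + q - p ≡ q
    cancel = solve-∀ ℚ-ring
  ∑-path≤ {e} E≤ 0≤e (suc k) b = begin
    ∑ (allVecs n (suc (suc k))) (path b)
      ≡⟨ ∑-allVecs-suc n (suc k) (path b) ⟩
    ∑[ w ← W ] ∑[ x ← V ] edge b x (head w) · path (not b) w
      ≡⟨ ∑-cong W (λ w → trans (∑-·ʳ V (path (not b) w) _) (cong (_· path (not b) w) (∑-cong V λ x → edge-sym b x (head w)))) ⟩
    ∑[ w ← W ] degree b (head w) · path (not b) w
      ≤⟨ ∑-mono-≤ W (λ w → ≤-trans (·-monoʳ-≤ (path-nonNeg (not b) w) (degree≤ b (head w)))
           (≤-trans (≤-reflexive (*-distribʳ-+ (path (not b) w) h _))
             (+-monoʳ-≤ (h · path (not b) w) (≤-trans (·-monoˡ-≤ (0≤½∣∣ (D (head w))) (path≤1 (not b) w)) (≤-reflexive (*-identityʳ _)))))) ⟩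
    ∑[ w ← W ] (h · path (not b) w + ½ · ∣ D (head w) ∣)
      ≡⟨ trans (∑-+ W _ _) (cong₂ _+_ (∑-·ˡ W h (path (not b))) (trans (∑-·ˡ W ½ _) (cong (½ ·_) (∑-allVecs-head n k (λ x → ∣ D x ∣))))) ⟩
    h · ∑ W (path (not b)) + ½ · (N ^ℚ k · E)
      ≤⟨ +-mono-≤ (·-monoˡ-≤ 0≤h (∑-path≤ E≤ 0≤e k (not b))) (·-monoˡ-≤ (nonNegative⁻¹ ½) (·-monoˡ-≤ (^-nonNeg k 0≤N) E≤)) ⟩
    h · (N · h ^ℚ k + e · N ^ℚ suc k) + ½ · (N ^ℚ k · (e · (N · N)))
      ≡⟨ identity N (h ^ℚ k) (N ^ℚ k) e ⟩
    N · h ^ℚ suc k + e · N ^ℚ suc (suc k)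
      ∎
    where
    open ≤-Reasoning
    W : List (Vec (Fin n) (suc k))
    W = allVecs n (suc k)
    0≤½∣∣ : ∀ p → 0ℚ ≤ℚ ½ · ∣ p ∣
    0≤½∣∣ p = ·-nonNeg (nonNegative⁻¹ ½) (0≤∣p∣ p)
    identity : ∀ m p q e → ½ · m · (m · p + e · (m · q)) + ½ · (q · (e · (m · m))) ≡ m · (½ · m · p) + e · (m · (m · q))
    identity = solve-∀ ℚ-ring

  form : (Fin n → Bool) → (Fin n → Bool) → ℚ
  form α β = ∑[ j ← V ] ∑[ i ← V ] s i j · sign (β i) · sign (α j)

  ∑-sign·D≤E : ∀ (β : Fin n → Bool) → ∑[ i ← V ] sign (β i) · D i ≤ℚ E
  ∑-sign·D≤E β = ∑-mono-≤ V (λ i → sign-·≤∣∣ (β i) (D i))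

  ∑-s-column : ∀ j → ∑[ i ← V ] s i j ≡ D j
  ∑-s-column j = ∑-cong V (λ i → s-sym i j)

  -- Of the eight sums in the expansion, N² and the trilinear one survive. The three others
  -- containing `s` reduce to row sums and are at most `E` each; the rest contain the total of one
  -- of the sign vectors.
  ∑-triple≤ : ∀ α β → ∑[ j ← V ] ∑[ i ← V ] (1ℚ + s i j) · (1ℚ + sign (α j)) · (1ℚ + sign (β i))
    ≤ℚ (N · N + form α β) + (E + E + E) + (N · ∣ ∑[ j ← V ] sign (α j) ∣ + 2ℚ · N · ∣ ∑[ i ← V ] sign (β i) ∣)
  ∑-triple≤ α β = begin
    ∑[ j ← V ] ∑[ i ← V ] (1ℚ + s i j) · (1ℚ + y j) · (1ℚ + z i)
      ≡⟨ ∑-cong V inner ⟩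
    ∑[ j ← V ] (((N + Z) + (N + Z) · y j) + ((D j + y j · D j) + (U j + U j · y j)))
      ≡⟨ trans (∑-+ V _ _) (cong₂ _+_ (trans (∑-+ V _ _) (cong₂ _+_ (∑-allFin-const n (N + Z)) (∑-·ˡ V (N + Z) y)))
           (trans (∑-+ V _ _) (cong₂ _+_ (∑-+ V _ _) (trans (∑-+ V _ _) (cong₂ _+_ ∑U (∑-cong V λ j → sym (∑-·ʳ V (y j) _))))))) ⟩
    N · (N + Z) + (N + Z) · Y + ((∑ V D + (∑[ j ← V ] y j · D j)) + ((∑[ i ← V ] z i · D i) + form α β))
      ≤⟨ +-mono-≤ (cross-terms) (+-mono-≤ (+-mono-≤ (∑-mono-≤ V λ i → p≤∣p∣ (D i)) (∑-sign·D≤E α)) (+-monoˡ-≤ (form α β) (∑-sign·D≤E β))) ⟩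
    N · N + (N · ∣ Y ∣ + 2ℚ · N · ∣ Z ∣) + ((E + E) + (E + form α β))
      ≡⟨ rearrange (N · N) (N · ∣ Y ∣ + 2ℚ · N · ∣ Z ∣) E (form α β) ⟩
    (N · N + form α β) + (E + E + E) + (N · ∣ Y ∣ + 2ℚ · N · ∣ Z ∣)
      ∎
    where
    open ≤-Reasoning
    y z U : Fin n → ℚ
    y j = sign (α j)
    z i = sign (β i)
    U j = ∑[ i ← V ] s i j · z i
    Y Z : ℚ
    Y = ∑ V y
    Z = ∑ V z
    expand : ∀ s y z → (1ℚ + s) · (1ℚ + y) · (1ℚ + z) ≡ (1ℚ + y) · ((1ℚ + z) + (s + s · z))
    expand = solve-∀ ℚ-ring
    collect : ∀ y m z d u → (1ℚ + y) · ((m + z) + (d + u)) ≡ ((m + z) + (m + z) · y) + ((d + y · d) + (u + u · y))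
    collect = solve-∀ ℚ-ring
    inner : ∀ j → ∑[ i ← V ] (1ℚ + s i j) · (1ℚ + y j) · (1ℚ + z i) ≡ ((N + Z) + (N + Z) · y j) + ((D j + y j · D j) + (U j + U j · y j))
    inner j = trans (∑-cong V λ i → expand (s i j) (y j) (z i)) (trans (∑-·ˡ V (1ℚ + y j) _)
      (trans (cong ((1ℚ + y j) ·_) (trans (∑-+ V _ _) (cong₂ _+_
        (trans (∑-+ V _ _) (cong (_+ Z) (trans (∑-allFin-const n 1ℚ) (*-identityʳ N))))
        (trans (∑-+ V _ _) (cong (_+ U j) (∑-s-column j))))))
        (collect (y j) N Z (D j) (U j))))
    ∑U : ∑ V U ≡ ∑[ i ← V ] z i · D i
    ∑U = trans (∑-comm V V _) (∑-cong V λ i → trans (∑-·ʳ V (z i) (s i)) (*-comm (D i) (z i)))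
    ZY≤ : Z · Y ≤ℚ N · ∣ Z ∣
    ZY≤ = ≤-trans (p≤∣p∣ (Z · Y)) (subst₂ _≤ℚ_ (trans (*-comm ∣ Y ∣ ∣ Z ∣) (sym (∣p*q∣≡∣p∣*∣q∣ Z Y))) refl
      (·-monoʳ-≤ (0≤∣p∣ Z) (∣∑-sign∣≤N α)))
    cross-terms : N · (N + Z) + (N + Z) · Y ≤ℚ N · N + (N · ∣ Y ∣ + 2ℚ · N · ∣ Z ∣)
    cross-terms = ≤-trans (≤-reflexive (lhs N Z Y)) (≤-trans
      (+-monoʳ-≤ (N · N) (+-mono-≤ (·-monoˡ-≤ 0≤N (p≤∣p∣ Y)) (+-mono-≤ (·-monoˡ-≤ 0≤N (p≤∣p∣ Z)) ZY≤)))
      (≤-reflexive (rhs N ∣ Z ∣ ∣ Y ∣)))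
      where
      lhs : ∀ m z y → m · (m + z) + (m + z) · y ≡ m · m + (m · y + (m · z + z · y))
      lhs = solve-∀ ℚ-ring
      rhs : ∀ m z y → m · m + (m · y + (m · z + m · z)) ≡ m · m + (m · y + 2ℚ · m · z)
      rhs = solve-∀ ℚ-ring
    rearrange : ∀ a b e t → a + b + ((e + e) + (e + t)) ≡ (a + t) + (e + e + e) + b
    rearrange = solve-∀ ℚ-ring

  -- The second edge of a closed walk is blue, hence `false`. As a sign vector in `j` this is minus
  -- the column of `s` at the head.
  to-head : ∀ {k} → Vec (Fin n) (suc k) → Fin n → Bool
  to-head p j = not (c j (head p) xor false)

  -- The three edges outside the path, at `i` and `j`, each contribute a factor ½ (1 ± s); this
  -- explains the 8.
  altWalk-factors : ∀ {k} i j (p : Vec (Fin n) (suc k)) → 8ℚ · indicator (altWalk c true i (toList (i ∷ᵥ j ∷ᵥ p)))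
    ≡ path true p · ((1ℚ + s i j) · (1ℚ + sign (to-head p j)) · (1ℚ + sign (closes true i p)))
  altWalk-factors i j p@(x ∷ᵥ _) = begin
    8ℚ · indicator (altWalk c true i (toList (i ∷ᵥ j ∷ᵥ p)))
      ≡⟨ cong (8ℚ ·_) (trans (indicator-∧ (not (c i j xor true)) _) (cong (edge true i j ·_) (trans (indicator-∧ (to-head p j) _)
           (cong₂ _·_ (indicator-sign (to-head p j)) (trans (altWalk-path true i p) (cong (path true p ·_) (indicator-sign (closes true i p)))))))) ⟩
    8ℚ · (edge true i j · ((½ · (1ℚ + sign (to-head p j))) · (path true p · (½ · (1ℚ + sign (closes true i p))))))
      ≡⟨ cong (λ r → 8ℚ · (r · ((½ · (1ℚ + sign (to-head p j))) · (path true p · (½ · (1ℚ + sign (closes true i p))))))) (edge-s true i j) ⟩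
    8ℚ · (½ · (1ℚ + 1ℚ · s i j) · ((½ · (1ℚ + sign (to-head p j))) · (path true p · (½ · (1ℚ + sign (closes true i p))))))
      ≡⟨ identity (s i j) (sign (to-head p j)) (sign (closes true i p)) (path true p) ⟩
    path true p · ((1ℚ + s i j) · (1ℚ + sign (to-head p j)) · (1ℚ + sign (closes true i p)))
      ∎
    where
    open ≡-Reasoning
    identity : ∀ s y z p → 8ℚ · (½ · (1ℚ + 1ℚ · s) · ((½ · (1ℚ + y)) · (p · (½ · (1ℚ + z))))) ≡ p · ((1ℚ + s) · (1ℚ + y) · (1ℚ + z))
    identity = solve-∀ ℚ-ring

  ∑-altWalk-form : ∀ m → 8ℚ · ∑-altWalk (suc (suc m)) ≤ℚ
    (∑[ p ← allVecs n (suc m) ] path true p · (N · N + form (to-head p) (λ i → closes true i p)))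
    + (∑ (allVecs n (suc m)) (path true) · (E + E + E) + (2ℚ + 1ℚ) · (N ^ℚ suc m · E))
  ∑-altWalk-form m = begin
    8ℚ · ∑-altWalk (suc (suc m))
      ≡⟨ cong (8ℚ ·_) (∑-allVecs-suc n (suc m) _) ⟩
    8ℚ · (∑[ p ← P ] ∑[ j ← V ] ∑[ i ← V ] indicator (altWalk c true i (toList (i ∷ᵥ j ∷ᵥ p))))
      ≡⟨ trans (sym (∑-·ˡ P 8ℚ _)) (∑-cong P λ p → trans (sym (∑-·ˡ V 8ℚ _)) (∑-cong V λ j → sym (∑-·ˡ V 8ℚ _))) ⟩
    ∑[ p ← P ] ∑[ j ← V ] ∑[ i ← V ] 8ℚ · indicator (altWalk c true i (toList (i ∷ᵥ j ∷ᵥ p)))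
      ≡⟨ ∑-cong P (λ p → trans (∑-cong V λ j → trans (∑-cong V λ i → altWalk-factors i j p) (∑-·ˡ V (path true p) _)) (∑-·ˡ V (path true p) _)) ⟩
    ∑[ p ← P ] path true p · (∑[ j ← V ] ∑[ i ← V ] (1ℚ + s i j) · (1ℚ + sign (to-head p j)) · (1ℚ + sign (closes true i p)))
      ≤⟨ ∑-mono-≤ P (λ p → ≤-trans (·-monoˡ-≤ (path-nonNeg true p) (∑-triple≤ (to-head p) (λ i → closes true i p))) (drop-path p)) ⟩
    ∑[ p ← P ] (path true p · Φ p + (path true p · (E + E + E) + (N · ∣ D (head p) ∣ + 2ℚ · N · ∣∑-closes∣ true p)))
      ≡⟨ trans (∑-+ P _ _) (cong ((∑[ p ← P ] path true p · Φ p) +_) (trans (∑-+ P _ _)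
           (cong₂ _+_ (∑-·ʳ P (E + E + E) (path true)) (trans (∑-+ P _ _)
             (cong₂ _+_ (trans (∑-·ˡ P N _) (cong (N ·_) (∑-allVecs-head n m (λ x → ∣ D x ∣))))
                        (trans (∑-·ˡ P (2ℚ · N) _) (cong ((2ℚ · N) ·_) (∑-∣∑-closes∣ m true)))))))) ⟩
    (∑[ p ← P ] path true p · Φ p) + (∑ P (path true) · (E + E + E) + (N · (N ^ℚ m · E) + 2ℚ · N · (N ^ℚ m · E)))
      ≡⟨ cong (λ r → (∑[ p ← P ] path true p · Φ p) + (∑ P (path true) · (E + E + E) + r)) (identity N (N ^ℚ m) E) ⟩
    (∑[ p ← P ] path true p · Φ p) + (∑ P (path true) · (E + E + E) + (2ℚ + 1ℚ) · (N ^ℚ suc m · E))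
      ∎
    where
    open ≤-Reasoning
    P : List (Vec (Fin n) (suc m))
    P = allVecs n (suc m)
    Φ : Vec (Fin n) (suc m) → ℚ
    Φ p = N · N + form (to-head p) (λ i → closes true i p)
    identity : ∀ m p e → m · (p · e) + 2ℚ · m · (p · e) ≡ (2ℚ + 1ℚ) · (m · p · e)
    identity = solve-∀ ℚ-ring
    ∣∑-to-head∣ : ∀ p → ∣ ∑[ j ← V ] sign (to-head p j) ∣ ≡ ∣ D (head p) ∣
    ∣∑-to-head∣ p = trans (cong ∣_∣ (∑-cong V λ j → cong (λ r → sign (not (r xor false))) (c-sym j (head p)))) (∣∑-sign-edge∣ false (head p))
    distrib : ∀ p a b x → p · (a + b + x) ≡ p · a + (p · b + p · x)
    distrib = solve-∀ ℚ-ring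
    -- Dropping the weight `path` here makes the sums over the end vertices exact, but replaces h^m
    -- by N^m and so costs the factor 2^m.
    drop-path : ∀ p → path true p · (Φ p + (E + E + E) + (N · ∣ ∑[ j ← V ] sign (to-head p j) ∣ + 2ℚ · N · ∣∑-closes∣ true p))
      ≤ℚ path true p · Φ p + (path true p · (E + E + E) + (N · ∣ D (head p) ∣ + 2ℚ · N · ∣∑-closes∣ true p))
    drop-path p = ≤-trans (≤-reflexive (trans
        (cong (λ r → path true p · (Φ p + (E + E + E) + (N · r + 2ℚ · N · ∣∑-closes∣ true p))) (∣∑-to-head∣ p))
        (distrib (path true p) (Φ p) (E + E + E) X)))
      (+-monoʳ-≤ (path true p · Φ p) (+-monoʳ-≤ (path true p · (E + E + E))
        (subst (path true p · X ≤ℚ_) (*-identityˡ X) (·-monoʳ-≤ 0≤X (path≤1 true p)))))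
      where
      X : ℚ
      X = N · ∣ D (head p) ∣ + 2ℚ · N · ∣∑-closes∣ true p
      0≤X : 0ℚ ≤ℚ X
      0≤X = +-nonNeg (·-nonNeg 0≤N (0≤∣p∣ (D (head p)))) (·-nonNeg (·-nonNeg (nonNegative⁻¹ 2ℚ) 0≤N) (0≤∣p∣ (∑[ v ← V ] sign (closes true v p))))

  -- From a large form to a symmetric rank one matrix

  ∑∑ : (Fin n → Fin n → ℚ) → ℚ
  ∑∑ f = ∑[ j ← V ] ∑[ i ← V ] f j i

  ∑∑-+ : ∀ f g → ∑∑ (λ j i → f j i + g j i) ≡ ∑∑ f + ∑∑ g
  ∑∑-+ f g = trans (∑-cong V λ j → ∑-+ V (f j) (g j)) (∑-+ V _ _)

  ∑∑-neg : ∀ f → ∑∑ (λ j i → - f j i) ≡ - ∑∑ f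
  ∑∑-neg f = trans (∑-cong V λ j → ∑-neg V (f j)) (∑-neg V _)

  ∑∑-const : ∀ a → ∑∑ (λ _ _ → a) ≡ N · (N · a)
  ∑∑-const a = trans (∑-cong V λ _ → ∑-allFin-const n a) (∑-allFin-const n (N · a))

  ∑∑-product : ∀ f g → ∑∑ (λ j i → f i · g j) ≡ ∑ V f · ∑ V g
  ∑∑-product f g = trans (∑-cong V λ j → ∑-·ʳ V (g j) f) (∑-·ˡ V (∑ V f) g)

  ∑∑-mono-≤ : ∀ {f g} → (∀ j i → f j i ≤ℚ g j i) → ∑∑ f ≤ℚ ∑∑ g
  ∑∑-mono-≤ f≤g = ∑-mono-≤ V λ j → ∑-mono-≤ V (f≤g j)

  ∑∑-cong : ∀ {f g} → (∀ j i → f j i ≡ g j i) → ∑∑ f ≡ ∑∑ g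
  ∑∑-cong f≗g = ∑-cong V λ j → ∑-cong V (f≗g j)

  ∑∑-+-1 : ∀ f g → ∑∑ (λ j i → f j i + g j i - 1ℚ) ≡ ∑∑ f + ∑∑ g - N · N
  ∑∑-+-1 f g = trans (∑∑-+ _ _) (cong₂ _+_ (∑∑-+ f g) (trans (∑∑-const (- 1ℚ)) (N·N·-1 N)))
    where
    N·N·-1 : ∀ m → m · (m · (- 1ℚ)) ≡ - (m · m)
    N·N·-1 = solve-∀ ℚ-ring

  total : (Fin n → Bool) → ℚ
  total α = ∑[ i ← V ] sign (α i)

  module _ (α β : Fin n → Bool) where
    private
      y z u : Fin n → ℚ
      y i = sign (α i)
      z i = sign (β i)
      u i = z i · y i

      U : ℚ
      U = ∑ V u

    u-sign : ∀ i → u i ≡ sign (not (β i xor α i))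
    u-sign i = sign-· (β i) (α i)

    u≤1 : ∀ i → u i ≤ℚ 1ℚ
    u≤1 i = subst (_≤ℚ 1ℚ) (sym (u-sign i)) (sign≤1 (not (β i xor α i)))

    -u≤1 : ∀ i → - u i ≤ℚ 1ℚ
    -u≤1 i = subst (_≤ℚ 1ℚ) (trans (sign-not (not (β i xor α i))) (cong -_ (sym (u-sign i)))) (sign≤1 (not (not (β i xor α i))))

    form-swap : ∑∑ (λ j i → s i j · z j · y i) ≡ form α β
    form-swap = trans (∑-comm V V _) (∑∑-cong λ j i → cong (λ r → r · z i · y j) (s-sym j i))

    -- By symmetry of `s` the entries s z_i y_j and s z_j y_i have the same sum, and their product
    -- is u_i u_j because s² = 1. So a form near N² forces U near N or -N.
    2form≤U² : form α β + form α β - N · N ≤ℚ U · U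
    2form≤U² = subst₂ _≤ℚ_
      (trans (∑∑-+-1 _ _) (cong (λ r → form α β + r - N · N) form-swap))
      (∑∑-product u u)
      (∑∑-mono-≤ λ j i → ≤-trans (p+q-1≤p·q (sign-·-·≤1 (c i j) (β i) (α j)) (sign-·-·≤1 (c i j) (β j) (α i)))
        (≤-reflexive (trans (rearrange (s i j) (z i) (y j) (z j) (y i)) (trans (cong (_· (u i · u j)) (sign-square (c i j))) (*-identityˡ _)))))
      where
      rearrange : ∀ s z y z′ y′ → s · z · y · (s · z′ · y′) ≡ s · s · (z · y′ · (z′ · y))
      rearrange = solve-∀ ℚ-ring

    z·u≡y : ∀ s′ i y′ → s′ · z i · y′ · u i ≡ s′ · y i · y′
    z·u≡y s′ i y′ = trans (rearrange s′ (z i) (y i) y′) (trans (cong (_· (s′ · y i · y′)) (sign-square (β i))) (*-identityˡ _))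
      where
      rearrange : ∀ s z y y′ → s · z · y′ · (z · y) ≡ z · z · (s · y · y′)
      rearrange = solve-∀ ℚ-ring

    ∑∑-u : ∀ (f : Fin n → ℚ) → ∑∑ (λ _ i → f i) ≡ N · ∑ V f
    ∑∑-u f = ∑-allFin-const n (∑ V f)

    -- Multiplying the entry s z_i y_j by u_i = z_i y_i replaces z_i by y_i.
    form≤form-diagonal : form α β + N · U - N · N ≤ℚ form α α
    form≤form-diagonal = subst₂ _≤ℚ_
      (trans (∑∑-+-1 _ _) (cong (λ r → form α β + r - N · N) (∑∑-u u)))
      (∑∑-cong λ j i → z·u≡y (s i j) i (y j))
      (∑∑-mono-≤ λ j i → p+q-1≤p·q (sign-·-·≤1 (c i j) (β i) (α j)) (u≤1 i))

    form≤-form-diagonal : form α β + N · (- U) - N · N ≤ℚ - form α α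
    form≤-form-diagonal = subst₂ _≤ℚ_
      (trans (∑∑-+-1 _ _) (cong (λ r → form α β + r - N · N) (trans (∑∑-u (λ i → - u i)) (cong (N ·_) (∑-neg V u)))))
      (trans (∑∑-cong λ j i → trans (sym (neg-distribʳ-* (s i j · z i · y j) (u i))) (cong -_ (z·u≡y (s i j) i (y j)))) (∑∑-neg _))
      (∑∑-mono-≤ λ j i → p+q-1≤p·q (sign-·-·≤1 (c i j) (β i) (α j)) (-u≤1 i))

    ∣U∣≤N : ∣ U ∣ ≤ℚ N
    ∣U∣≤N = subst (λ r → ∣ r ∣ ≤ℚ N) (sym (∑-cong V u-sign)) (∣∑-sign∣≤N (λ i → not (β i xor α i)))

    -- Trading U² for N |U| avoids a root and gives a bound that can be added to
    -- `form≤form-diagonal`.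
    2form≤N·∣U∣ : form α β + form α β - N · N ≤ℚ N · ∣ U ∣
    2form≤N·∣U∣ = ≤-trans 2form≤U² (subst (_≤ℚ N · ∣ U ∣) (∣p∣·∣p∣≡p·p U) (·-monoʳ-≤ (0≤∣p∣ U) ∣U∣≤N))

    -- The passage to the diagonal form loses the gap N² - form once, and N - |U| accounts for it
    -- twice. The sign of U decides between the alternatives.
    form-diagonal-large : (N · N - form α α ≤ℚ (2ℚ + 1ℚ) · (N · N - form α β))
                        ⊎ (N · N - (- form α α) ≤ℚ (2ℚ + 1ℚ) · (N · N - form α β))
    form-diagonal-large with ∣p∣≡p∨∣p∣≡-p U
    ... | inj₁ ∣U∣≡U  = inj₁ (≤-from-difference
          (+-nonNeg (p≤q⇒0≤q-p form≤form-diagonal) (p≤q⇒0≤q-p 2form≤N·∣U∣))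
          (trans (identity (N · N) (form α β) (form α α) (N · U)) (cong (λ r → (form α α - (form α β + N · U - N · N)) + (N · r - (form α β + form α β - N · N))) (sym ∣U∣≡U))))
      where
      identity : ∀ m f q v → (2ℚ + 1ℚ) · (m - f) - (m - q) ≡ (q - (f + v - m)) + (v - (f + f - m))
      identity = solve-∀ ℚ-ring
    ... | inj₂ ∣U∣≡-U = inj₂ (≤-from-difference
          (+-nonNeg (p≤q⇒0≤q-p form≤-form-diagonal) (p≤q⇒0≤q-p 2form≤N·∣U∣))
          (trans (identity (N · N) (form α β) (- form α α) (N · (- U))) (cong (λ r → (- form α α - (form α β + N · (- U) - N · N)) + (N · r - (form α β + form α β - N · N))) (sym ∣U∣≡-U))))
      where
      identity : ∀ m f q v → (2ℚ + 1ℚ) · (m - f) - (m - q) ≡ (q - (f + v - m)) + (v - (f + f - m))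
      identity = solve-∀ ℚ-ring

  -- The partition given by a sign vector

  module _ (α : Fin n → Bool) where
    private
      y : Fin n → ℚ
      y i = sign (α i)

      Y : ℚ
      Y = total α

      s·s·y·y : ∀ i j → s i j · s i j · (y i · y j) ≡ y i · y j
      s·s·y·y i j = trans (cong (_· (y i · y j)) (sign-square (c i j))) (*-identityˡ (y i · y j))

    -- For signs, |y y′ - s| = 1 - s y y′, and these terms sum to N² - form; the sum of all `s` is
    -- at most `E`. For `total²≤′` the same is done with -s.
    total²≤ : Y · Y ≤ℚ E + (N · N - form α α)
    total²≤ = ≤-trans (subst₂ _≤ℚ_ (∑∑-product y y)
        (trans (∑∑-+ _ _) (cong₂ _+_ (∑-cong V ∑-s-column) (trans (∑∑-+ _ _) (cong₂ _+_ (trans (∑∑-const 1ℚ) (cong (N ·_) (*-identityʳ N))) (∑∑-neg _)))))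
        (∑∑-mono-≤ λ j i → ≤-from-difference
          (·-nonNeg (p≤q⇒0≤q-p (sign-·-·≤1 (c i j) (α i) (α j))) (p≤q⇒0≤q-p (-1≤sign (c i j))))
          (trans (cong (λ r → s i j + (1ℚ - s i j · y i · y j) - r) (sym (s·s·y·y i j))) (identity (s i j) (y i) (y j)))))
      (+-monoˡ-≤ (N · N - form α α) (∑-mono-≤ V λ j → p≤∣p∣ (D j)))
      where
      identity : ∀ s y y′ → s + (1ℚ - s · y · y′) - s · s · (y · y′) ≡ (1ℚ - s · y · y′) · (s - - 1ℚ)
      identity = solve-∀ ℚ-ring

    total²≤′ : Y · Y ≤ℚ E + (N · N - - form α α)
    total²≤′ = ≤-trans (subst₂ _≤ℚ_ (∑∑-product y y)
        (trans (∑∑-+ _ _) (cong₂ _+_ (trans (∑∑-neg _) (trans (cong -_ (∑-cong V ∑-s-column)) (sym (∑-neg V D))))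
          (trans (∑∑-+ _ _) (cong₂ _+_ (trans (∑∑-const 1ℚ) (cong (N ·_) (*-identityʳ N))) (sym (neg-involutive (form α α)))))))
        (∑∑-mono-≤ λ j i → ≤-from-difference
          (·-nonNeg (p≤q⇒0≤q-p (-1≤sign-·-· (c i j) (α i) (α j))) (p≤q⇒0≤q-p (sign≤1 (c i j))))
          (trans (cong (λ r → - s i j + (1ℚ + s i j · y i · y j) - r) (sym (s·s·y·y i j))) (identity (s i j) (y i) (y j)))))
      (+-monoˡ-≤ (N · N - - form α α) (∑-mono-≤ V λ j → -p≤∣p∣ (D j)))
      where
      identity : ∀ s y y′ → - s + (1ℚ + s · y · y′) - s · s · (y · y′) ≡ (s · y · y′ - - 1ℚ) · (1ℚ - s)
      identity = solve-∀ ℚ-ring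

    X : Subset n
    X = tabulate α

    private
      ∑∑-indicator : ∀ (b : Fin n → Fin n → Bool) (f : Fin n → Fin n → ℚ) → (∀ i j → sign (b i j) ≡ f j i) →
        ∑[ i ← V ] ∑[ j ← V ] indicator (b i j) ≡ ½ · (N · N + ∑∑ f)
      ∑∑-indicator b f b≗f = begin
        ∑[ i ← V ] ∑[ j ← V ] indicator (b i j)                    ≡⟨ ∑-comm V V _ ⟩
        ∑∑ (λ j i → indicator (b i j))                             ≡⟨ ∑∑-cong (λ j i → trans (indicator-sign (b i j)) (cong (λ r → ½ · (1ℚ + r)) (b≗f i j))) ⟩
        ∑∑ (λ j i → ½ · (1ℚ + f j i))                              ≡⟨ trans (∑-cong V λ j → ∑-·ˡ V ½ _) (∑-·ˡ V ½ _) ⟩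
        ½ · ∑∑ (λ j i → 1ℚ + f j i)                                ≡⟨ cong (½ ·_) (trans (∑∑-+ _ f) (cong (_+ ∑∑ f) (trans (∑∑-const 1ℚ) (cong (N ·_) (*-identityʳ N))))) ⟩
        ½ · (N · N + ∑∑ f)                                         ∎
        where open ≡-Reasoning

      -- Each `xor` contributes a minus sign and the two cancel; hence the sizes of the symmetric
      -- differences are read off from `form α α`.
      sign-crossing : ∀ r i j → sign (r xor crossing X i j) ≡ sign r · y i · y j
      sign-crossing r i j = begin
        sign (r xor crossing X i j)                    ≡⟨ cong₂ (λ a b → sign (r xor (a xor b))) (lookup∘tabulate α i) (lookup∘tabulate α j) ⟩
        sign (r xor (α i xor α j))                     ≡⟨ sign-xor r (α i xor α j) ⟩
        - (sign r · sign (α i xor α j))                ≡⟨ cong (λ p → - (sign r · p)) (sign-xor (α i) (α j)) ⟩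
        - (sign r · - (y i · y j))                     ≡⟨ identity (sign r) (y i) (y j) ⟩
        sign r · y i · y j                             ∎
        where
        open ≡-Reasoning
        identity : ∀ r a b → - (r · - (a · b)) ≡ r · a · b
        identity = solve-∀ ℚ-ring

    symDiffBlue≤ : ℕ→ℚ (symDiffBlue n c X) ≤ℚ ½ · (N · N - form α α)
    symDiffBlue≤ = ≤-trans (countPairs≤∑ n _) (≤-reflexive (trans
      (∑∑-indicator (λ i j → not (c i j) xor crossing X i j) (λ j i → - (s i j · y i · y j)) (λ i j → trans (sign-crossing (not (c i j)) i j)
        (trans (cong (λ r → r · y i · y j) (sign-not (c i j))) (neg-out (s i j) (y i) (y j)))))
      (cong (λ r → ½ · (N · N + r)) (∑∑-neg _))))
      where
      neg-out : ∀ s a b → (- s) · a · b ≡ - (s · a · b)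
      neg-out = solve-∀ ℚ-ring

    symDiffRed≤ : ℕ→ℚ (symDiffRed n c X) ≤ℚ ½ · (N · N - - form α α)
    symDiffRed≤ = ≤-trans (countPairs≤∑ n _) (≤-reflexive (trans
      (∑∑-indicator (λ i j → c i j xor crossing X i j) (λ j i → s i j · y i · y j) (λ i j → sign-crossing (c i j) i j))
      (cong (λ r → ½ · (N · N + r)) (sym (neg-involutive (form α α))))))

    card-X : ℕ→ℚ (card X) ≡ ½ · (N + Y)
    card-X = begin
      ℕ→ℚ (card X)                             ≡⟨ ℕ→ℚ-card X ⟩
      ∑[ i ← V ] indicator (lookup X i)        ≡⟨ ∑-cong V (λ i → trans (cong indicator (lookup∘tabulate α i)) (indicator-sign (α i))) ⟩
      ∑[ i ← V ] ½ · (1ℚ + y i)                ≡⟨ ∑-·ˡ V ½ _ ⟩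
      ½ · (∑[ i ← V ] (1ℚ + y i))              ≡⟨ cong (½ ·_) (trans (∑-+ V _ y) (cong (_+ Y) (trans (∑-allFin-const n 1ℚ) (*-identityʳ N)))) ⟩
      ½ · (N + Y)                              ∎
      where open ≡-Reasoning

    card-complement : ℕ→ℚ (n ∸ card X) ≡ ½ · (N + - Y)
    card-complement = trans (ℕ→ℚ-∸ (∣p∣≤n X)) (trans (cong (λ r → N - r) card-X) (identity N Y))
      where
      identity : ∀ m y → m - ½ · (m + y) ≡ ½ · (m + - y)
      identity = solve-∀ ℚ-ring

  -- Stability

  -- With θ = 1/n, ((n - 1)/2)^k = h^k (1 - θ)^k ≥ h^k (1 - k θ) by Bernoulli, and k θ ≤ ε. Together
  -- with the given factor 1 - ε this leaves (1 - ε)² ≥ 1 - 2ε.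
  walks-from-cycles : 1 ≤ n → ∀ {ε} → 0ℚ ≤ℚ ε → ε ≤ℚ 1ℚ → ∀ k →
    ℕ→ℚ k ≤ℚ ℕ→ℚ n · ε →
    (1ℚ - ε) · ℕ→ℚ n · ((n ∸ 1) ÷ℕ 2) ^ℚ k < ℕ→ℚ (count (isRootedAlt c) (allVecs n (suc k))) →
    (1ℚ - 2ℚ · ε) · (N · h ^ℚ k) < ∑-altWalk k
  walks-from-cycles 1≤n {ε} 0≤ε ε≤1 k k≤Nε many = ≤-<-trans lower (<-≤-trans many (ℕ→ℚ-rooted≤ k))
    where
    open ≤-Reasoning
    θ g : ℚ
    θ = inv N
    g = (n ∸ 1) ÷ℕ 2
    0≤θ : 0ℚ ≤ℚ θ
    0≤θ = inv-nonNeg 0≤N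
    N·θ≡1 : N · θ ≡ 1ℚ
    N·θ≡1 = inv-inverse 0<n
    θ≤1 : θ ≤ℚ 1ℚ
    θ≤1 = subst₂ _≤ℚ_ (*-identityˡ θ) N·θ≡1 (·-monoʳ-≤ 0≤θ (ℕ→ℚ-mono-≤ 1≤n))
    g≡ : g ≡ h · (1ℚ - θ)
    g≡ = begin-equality
      g                              ≡⟨ half g ⟩
      ½ · (2ℚ · g)                   ≡⟨ cong (½ ·_) (a/[1+d]·[1+d]≡a (n ∸ 1) 1) ⟩
      ½ · ℕ→ℚ (n ∸ 1)                ≡⟨ cong (½ ·_) (ℕ→ℚ-∸ 1≤n) ⟩
      ½ · (N - 1ℚ)                   ≡⟨ cong (λ r → ½ · (N - r)) N·θ≡1 ⟨
      ½ · (N - N · θ)                ≡⟨ factor N θ ⟩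
      h · (1ℚ - θ)                   ∎
      where
      half : ∀ g → g ≡ ½ · (2ℚ · g)
      half = solve-∀ ℚ-ring
      factor : ∀ m t → ½ · (m - m · t) ≡ ½ · m · (1ℚ - t)
      factor = solve-∀ ℚ-ring
    k·θ≤ε : ℕ→ℚ k · θ ≤ℚ ε
    k·θ≤ε = begin
      ℕ→ℚ k · θ          ≤⟨ ·-monoʳ-≤ 0≤θ k≤Nε ⟩
      N · ε · θ          ≡⟨ rearrange N ε θ ⟩
      N · θ · ε          ≡⟨ cong (_· ε) N·θ≡1 ⟩
      1ℚ · ε             ≡⟨ *-identityˡ ε ⟩
      ε                  ∎
      where
      rearrange : ∀ a b c → a · b · c ≡ a · c · b
      rearrange = solve-∀ ℚ-ring
    lower : (1ℚ - 2ℚ · ε) · (N · h ^ℚ k) ≤ℚ (1ℚ - ε) · N · g ^ℚ k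
    lower = begin
      (1ℚ - 2ℚ · ε) · (N · h ^ℚ k)
        ≤⟨ ·-monoʳ-≤ (·-nonNeg 0≤N (^-nonNeg k 0≤h)) 1-2ε≤[1-ε]² ⟩
      (1ℚ - ε) · (1ℚ - ε) · (N · h ^ℚ k)
        ≡⟨ rearrange (1ℚ - ε) (1ℚ - ε) N (h ^ℚ k) ⟩
      (1ℚ - ε) · N · h ^ℚ k · (1ℚ - ε)
        ≤⟨ ·-monoˡ-≤ (·-nonNeg (·-nonNeg (p≤q⇒0≤q-p ε≤1) 0≤N) (^-nonNeg k 0≤h))
             (≤-trans (+-monoʳ-≤ 1ℚ (neg-antimono-≤ k·θ≤ε)) (bernoulli k 0≤θ θ≤1)) ⟩
      (1ℚ - ε) · N · h ^ℚ k · (1ℚ - θ) ^ℚ k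
        ≡⟨ *-assoc ((1ℚ - ε) · N) (h ^ℚ k) ((1ℚ - θ) ^ℚ k) ⟩
      (1ℚ - ε) · N · (h ^ℚ k · (1ℚ - θ) ^ℚ k)
        ≡⟨ cong ((1ℚ - ε) · N ·_) (trans (sym (^-distrib-· h (1ℚ - θ) k)) (cong (_^ℚ k) (sym g≡))) ⟩
      (1ℚ - ε) · N · g ^ℚ k
        ∎
      where
      square : ∀ ε → (1ℚ - ε) · (1ℚ - ε) - (1ℚ - 2ℚ · ε) ≡ ε · ε
      square = solve-∀ ℚ-ring
      1-2ε≤[1-ε]² : 1ℚ - 2ℚ · ε ≤ℚ (1ℚ - ε) · (1ℚ - ε)
      1-2ε≤[1-ε]² = ≤-from-difference (square-nonNeg ε) (square ε)
      rearrange : ∀ a b m p → a · b · (m · p) ≡ a · m · p · b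
      rearrange = solve-∀ ℚ-ring

  module Dense (2≤n : 2 ≤ n) {ε : ℚ} (0≤ε : 0ℚ ≤ℚ ε) (m : ℕ) (ε-small : L m · L m · ε ≤ℚ 1ℚ)
    (many : (1ℚ - 2ℚ · ε) · (N · h ^ℚ suc (suc m)) < ∑-altWalk (suc (suc m))) where

    private
      θ : ℚ
      θ = inv N

      0≤θ : 0ℚ ≤ℚ θ
      0≤θ = inv-nonNeg 0≤N

      N·θ≡1 : N · θ ≡ 1ℚ
      N·θ≡1 = inv-inverse 0<n

      f : Fin n → ℚ
      f i = ∣ D i ∣ · θ

    ∑-balance≥ : 2ℚ · ((1ℚ - 2ℚ · ε) · N) ≤ℚ ∑ V balance + N
    ∑-balance≥ = ·-cancelˡ-≤ (^-pos (suc (suc m)) 0<h) (≤-trans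
      (≤-reflexive (rearrange (h ^ℚ suc (suc m)) (1ℚ - 2ℚ · ε) N))
      (≤-trans (·-monoˡ-≤ (nonNegative⁻¹ 2ℚ) (<⇒≤ many)) (∑-altWalk≤ m)))
      where
      rearrange : ∀ a b m → a · (2ℚ · (b · m)) ≡ 2ℚ · (b · (m · a))
      rearrange = solve-∀ ℚ-ring

    -- The sum of `balance` is N minus the left-hand side, so the deficit in `∑-balance≥` is exactly
    -- this sum.
    ∑-f²≤ : ∑[ i ← V ] f i · f i ≤ℚ 4ℚ · ε · N
    ∑-f²≤ = ≤-from-difference (p≤q⇒0≤q-p ∑-balance≥)
      (trans (identity ε N (∑[ i ← V ] f i · f i)) (cong (λ r → r + N - 2ℚ · ((1ℚ - 2ℚ · ε) · N)) (sym ∑-balance)))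
      where
      f² : ∀ i → - (f i · f i) ≡ - (D i · θ · (D i · θ))
      f² i = cong -_ (trans (·-interchange (∣ D i ∣) θ (∣ D i ∣) θ) (trans (cong (_· (θ · θ)) (∣p∣·∣p∣≡p·p (D i))) (sym (·-interchange (D i) θ (D i) θ))))
      ∑-balance : ∑ V balance ≡ N - (∑[ i ← V ] f i · f i)
      ∑-balance = trans (∑-cong V λ i → cong (1ℚ +_) (sym (f² i)))
        (trans (∑-+ V _ _) (cong₂ _+_ (trans (∑-allFin-const n 1ℚ) (*-identityʳ N)) (∑-neg V _)))
      identity : ∀ ε m s → 4ℚ · ε · m - s ≡ m - s + m - 2ℚ · ((1ℚ - 2ℚ · ε) · m)
      identity = solve-∀ ℚ-ring

    -- The mean of |D|/N. All errors are expressed through this rational number, since 2√ε need not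
    -- be rational.
    e : ℚ
    e = ∑ V f · θ

    e-nonNeg : 0ℚ ≤ℚ e
    e-nonNeg = ·-nonNeg (∑-nonNeg V λ i → ·-nonNeg (0≤∣p∣ (D i)) 0≤θ) 0≤θ

    E≡e·N² : E ≡ e · (N · N)
    E≡e·N² = sym (begin
      ∑ V f · θ · (N · N)            ≡⟨ cong (λ r → r · θ · (N · N)) (∑-·ʳ V θ (λ i → ∣ D i ∣)) ⟩
      E · θ · θ · (N · N)            ≡⟨ rearrange E θ N ⟩
      E · ((N · θ) · (N · θ))        ≡⟨ cong (λ r → E · (r · r)) N·θ≡1 ⟩
      E · 1ℚ                         ≡⟨ *-identityʳ E ⟩
      E                              ∎)
      where
      open ≡-Reasoning
      rearrange : ∀ a t m → a · t · t · (m · m) ≡ a · ((m · t) · (m · t))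
      rearrange = solve-∀ ℚ-ring

    e²≤4ε : e · e ≤ℚ 4ℚ · ε
    e²≤4ε = begin
      ∑ V f · θ · (∑ V f · θ)                  ≡⟨ ·-interchange (∑ V f) θ (∑ V f) θ ⟩
      ∑ V f · ∑ V f · (θ · θ)                  ≤⟨ ·-monoʳ-≤ (square-nonNeg θ) cauchy-schwarz ⟩
      N · (∑[ i ← V ] f i · f i) · (θ · θ)     ≤⟨ ·-monoʳ-≤ (square-nonNeg θ) (·-monoˡ-≤ 0≤N ∑-f²≤) ⟩
      N · (4ℚ · ε · N) · (θ · θ)               ≡⟨ rearrange N ε θ ⟩
      4ℚ · ε · ((N · θ) · (N · θ))             ≡⟨ cong (λ r → 4ℚ · ε · (r · r)) N·θ≡1 ⟩
      4ℚ · ε · 1ℚ                              ≡⟨ *-identityʳ (4ℚ · ε) ⟩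
      4ℚ · ε                                   ∎
      where
      open ≤-Reasoning
      cauchy-schwarz : ∑ V f · ∑ V f ≤ℚ N · (∑[ i ← V ] f i · f i)
      cauchy-schwarz = subst (λ k → ∑ V f · ∑ V f ≤ℚ ℕ→ℚ k · (∑[ i ← V ] f i · f i)) (List.length-tabulate {n = n} (λ i → i)) (∑-cauchy-schwarz V f)
      rearrange : ∀ m ε t → m · (4ℚ · ε · m) · (t · t) ≡ 4ℚ · ε · ((m · t) · (m · t))
      rearrange = solve-∀ ℚ-ring

    -- In `η`, 4ε covers the shortfall in the number of walks and `C · e` all error terms;
    -- `slack-identity` checks that this suffices.
    C η : ℚ
    C = 11ℚ · 2ℚ ^ℚ m
    η = 4ℚ · ε + C · e

    private
      p H : ℚ
      p = 2ℚ ^ℚ m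
      H = h ^ℚ m

      0≤p : 0ℚ ≤ℚ p
      0≤p = ^-nonNeg m (nonNegative⁻¹ 2ℚ)

    C-nonNeg : 0ℚ ≤ℚ C
    C-nonNeg = ·-nonNeg (ℕ→ℚ-nonNeg 11) 0≤p

    η-nonNeg : 0ℚ ≤ℚ η
    η-nonNeg = +-nonNeg (·-nonNeg (nonNegative⁻¹ 4ℚ) 0≤ε) (·-nonNeg C-nonNeg e-nonNeg)

    N^m≡p·H : N ^ℚ m ≡ p · H
    N^m≡p·H = trans (cong (_^ℚ m) (double N)) (^-distrib-· 2ℚ h m)
      where
      double : ∀ r → r ≡ 2ℚ · (½ · r)
      double = solve-∀ ℚ-ring

    private
      P : List (Vec (Fin n) (suc m))
      P = allVecs n (suc m)

      S τ bound : ℚ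
      S = ∑ P (path true)
      τ = (2ℚ - η) · (N · N)
      bound = (1ℚ + e · p) · (2ℚ - η + 3ℚ · e) + 3ℚ · (p · e)

      closing-form : Vec (Fin n) (suc m) → ℚ
      closing-form w = N · N + form (to-head w) (λ i → closes true i w)

    bound≤ : e ≤ℚ 1ℚ → bound ≤ℚ 2ℚ - 4ℚ · ε
    bound≤ e≤1 = ≤-from-difference
      (+-nonNeg (+-nonNeg (·-nonNeg (nonNegative⁻¹ 3ℚ) (·-nonNeg e-nonNeg (p≤q⇒0≤q-p (1≤^ m (ℕ→ℚ-mono-≤ (s≤s {n = 1} z≤n))))))
                          (·-nonNeg (nonNegative⁻¹ 3ℚ) (·-nonNeg (·-nonNeg 0≤p e-nonNeg) (p≤q⇒0≤q-p e≤1))))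
                (·-nonNeg (·-nonNeg e-nonNeg 0≤p) η-nonNeg))
      (slack-identity ε e p)

    -- The losing branch of the averaging argument: it contradicts `many`, so some path has a
    -- closing form of at least `τ`.
    ∑-altWalk-upper : e ≤ℚ 1ℚ → η ≤ℚ 1ℚ → ∑[ w ← P ] path true w · closing-form w ≤ℚ ∑[ w ← P ] path true w · τ →
      8ℚ · ∑-altWalk (suc (suc m)) ≤ℚ 8ℚ · ((1ℚ - 2ℚ · ε) · (N · h ^ℚ suc (suc m)))
    ∑-altWalk-upper e≤1 η≤1 small = begin
      8ℚ · ∑-altWalk (suc (suc m))
        ≤⟨ ∑-altWalk-form m ⟩
      (∑[ w ← P ] path true w · closing-form w) + (S · (E + E + E) + 3ℚ · (N ^ℚ suc m · E))
        ≤⟨ +-monoˡ-≤ (S · (E + E + E) + 3ℚ · (N ^ℚ suc m · E)) small ⟩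
      (∑[ w ← P ] path true w · τ) + (S · (E + E + E) + 3ℚ · (N ^ℚ suc m · E))
        ≡⟨ trans (cong (_+ (S · (E + E + E) + 3ℚ · (N ^ℚ suc m · E))) (∑-·ʳ P τ (path true))) (collect-identity S τ E (3ℚ · (N ^ℚ suc m · E))) ⟩
      S · (τ + (E + E + E)) + 3ℚ · (N ^ℚ suc m · E)
        ≤⟨ +-monoˡ-≤ (3ℚ · (N ^ℚ suc m · E)) (·-monoʳ-≤ 0≤τ+3E (∑-path≤ (≤-reflexive E≡e·N²) e-nonNeg m true)) ⟩
      (N · H + e · N ^ℚ suc m) · (τ + (E + E + E)) + 3ℚ · (N ^ℚ suc m · E)
        ≡⟨ cong₂ (λ a b → (N · H + e · (N · a)) · (τ + (b + b + b)) + 3ℚ · (N · a · b)) N^m≡p·H E≡e·N² ⟩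
      (N · H + e · (N · (p · H))) · (τ + (e · (N · N) + e · (N · N) + e · (N · N))) + 3ℚ · (N · (p · H) · (e · (N · N)))
        ≡⟨ factor-identity N H e p (2ℚ - η) ⟩
      N · (N · N) · H · bound
        ≤⟨ ·-monoˡ-≤ (·-nonNeg (·-nonNeg 0≤N (square-nonNeg N)) (^-nonNeg m 0≤h)) (bound≤ e≤1) ⟩
      N · (N · N) · H · (2ℚ - 4ℚ · ε)
        ≡⟨ lower-identity N H ε ⟩
      8ℚ · ((1ℚ - 2ℚ · ε) · (N · h ^ℚ suc (suc m)))
        ∎
      where
      open ≤-Reasoning
      0≤τ+3E : 0ℚ ≤ℚ τ + (E + E + E)
      0≤τ+3E = +-nonNeg (·-nonNeg (p≤q⇒0≤q-p (≤-trans η≤1 (ℕ→ℚ-mono-≤ (s≤s {n = 1} z≤n)))) (square-nonNeg N))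
        (+-nonNeg (+-nonNeg E-nonNeg E-nonNeg) E-nonNeg)

    large-form : e ≤ℚ 1ℚ → η ≤ℚ 1ℚ → Σ (Fin n → Bool) λ α → Σ (Fin n → Bool) λ β → N · N - form α β ≤ℚ η · (N · N)
    large-form e≤1 η≤1 = [ found , (λ small → p<q∧q≤p⇒⊥ (*-monoʳ-<-pos 8ℚ many) (∑-altWalk-upper e≤1 η≤1 small)) ]′
      (large-term-or-small-∑ P (path true) closing-form τ (path-nonNeg true))
      where
      found : (Σ (Vec (Fin n) (suc m)) λ w → τ ≤ℚ closing-form w) → _
      found (w , large) = to-head w , (λ i → closes true i w) ,
        ≤-from-difference (p≤q⇒0≤q-p large) (gap-identity η (N · N) (form (to-head w) (λ i → closes true i w)))

    0≤L : 0ℚ ≤ℚ L m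
    0≤L = ≤-trans (ℕ→ℚ-nonNeg 36) (36≤L m)

    1≤L : 1ℚ ≤ℚ L m
    1≤L = ≤-trans (ℕ→ℚ-mono-≤ (s≤s {n = 35} z≤n)) (36≤L m)

    k·ε≤1 : ∀ {k} → k ≤ℚ L m · L m → k · ε ≤ℚ 1ℚ
    k·ε≤1 k≤L² = ≤-trans (·-monoʳ-≤ 0≤ε k≤L²) ε-small

    L≤L² : L m ≤ℚ L m · L m
    L≤L² = subst (_≤ℚ L m · L m) (*-identityʳ (L m)) (·-monoˡ-≤ 0≤L 1≤L)

    L·ε≤1 : L m · ε ≤ℚ 1ℚ
    L·ε≤1 = k·ε≤1 L≤L²

    4·ε≤1 : 4ℚ · ε ≤ℚ 1ℚ
    4·ε≤1 = k·ε≤1 (≤-trans (≤-trans (ℕ→ℚ-mono-≤ {4} {36} (ℕ.m≤m+n 4 32)) (36≤L m)) L≤L²)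

    ε≤1 : ε ≤ℚ 1ℚ
    ε≤1 = subst (_≤ℚ 1ℚ) (*-identityˡ ε) (k·ε≤1 (≤-trans 1≤L L≤L²))

    0≤C₁ : 0ℚ ≤ℚ C₁ m
    0≤C₁ = ≤-trans 0≤1 (1≤C₁ m)

    C₁≤L : C₁ m ≤ℚ L m
    C₁≤L = ≤-trans (subst (_≤ℚ 36ℚ · C₁ m) (*-identityˡ (C₁ m)) (·-monoʳ-≤ 0≤C₁ 1≤36))
      (subst (_≤ℚ L m) (*-identityʳ (36ℚ · C₁ m)) (·-monoˡ-≤ (·-nonNeg (ℕ→ℚ-nonNeg 36) 0≤C₁) (≤-trans 1≤36 (36≤36·C₁ m))))
      where
      1≤36 : 1ℚ ≤ℚ 36ℚ
      1≤36 = ℕ→ℚ-mono-≤ (s≤s {n = 35} z≤n)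

    -- From (a + b)² = 2a² + 2b² - (a - b)² with a = 4ε and b = C e: here 2a² ≤ 32 ε and 2b² ≤ 8 C²
    -- ε.
    η²≤C₁·ε : η · η ≤ℚ C₁ m · ε
    η²≤C₁·ε = ≤-from-difference
      (+-nonNeg (+-nonNeg (square-nonNeg (4ℚ · ε - C · e)) (·-nonNeg (·-nonNeg (ℕ→ℚ-nonNeg 32) 0≤ε) (p≤q⇒0≤q-p ε≤1)))
                (·-nonNeg (·-nonNeg (nonNegative⁻¹ 2ℚ) (square-nonNeg C)) (p≤q⇒0≤q-p e²≤4ε)))
      (identity C ε e)
      where
      identity : ∀ C ε e → (ℕ→ℚ 32 + ℕ→ℚ 8 · (C · C)) · ε - (4ℚ · ε + C · e) · (4ℚ · ε + C · e)
        ≡ (4ℚ · ε - C · e) · (4ℚ · ε - C · e) + ℕ→ℚ 32 · ε · (1ℚ - ε) + 2ℚ · (C · C) · (4ℚ · ε - e · e)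
      identity = solve-∀ ℚ-ring

    e≤1 : e ≤ℚ 1ℚ
    e≤1 = square-cancel-≤ 0≤1 (≤-trans e²≤4ε 4·ε≤1)

    η≤1 : η ≤ℚ 1ℚ
    η≤1 = square-cancel-≤ 0≤1 (≤-trans η²≤C₁·ε (k·ε≤1 (≤-trans C₁≤L L≤L²)))

    -- N² ≤ 4 C(n,2) turns the bound (3/2) η N² into 6 η C(n,2). With κ = (6η)² ≤ 36 C₁ ε one even
    -- has κ² ≤ L ε², which is where `L` comes from.
    symDiff-bound : ∀ x {M} → x ≤ℚ ½ · M → M ≤ℚ 3ℚ · (η · (N · N)) → LeRoot32 ((4 ÷ℕ 1) · ε) x (choose2 n)
    symDiff-bound x {M} x≤½M M≤ = leRoot32 {L m} {ε} {6ℚ · η · (6ℚ · η)} {6ℚ · η · choose2 n} x (choose2 n) 0≤ε 0≤L L·ε≤1 ε-small (square-nonNeg (6ℚ · η)) κ²≤Lε x≤6η·choose2 (≤-reflexive (·-interchange (6ℚ · η) (choose2 n) (6ℚ · η) (choose2 n)))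
      where
      open ≤-Reasoning
      κ≤ : 6ℚ · η · (6ℚ · η) ≤ℚ 36ℚ · C₁ m · ε
      κ≤ = begin
        6ℚ · η · (6ℚ · η)     ≡⟨ ·-interchange 6ℚ η 6ℚ η ⟩
        36ℚ · (η · η)         ≤⟨ ·-monoˡ-≤ (ℕ→ℚ-nonNeg 36) η²≤C₁·ε ⟩
        36ℚ · (C₁ m · ε)      ≡⟨ *-assoc 36ℚ (C₁ m) ε ⟨
        36ℚ · C₁ m · ε        ∎
      κ²≤Lε : 6ℚ · η · (6ℚ · η) · (6ℚ · η · (6ℚ · η)) ≤ℚ L m · ε
      κ²≤Lε = begin
        6ℚ · η · (6ℚ · η) · (6ℚ · η · (6ℚ · η))    ≤⟨ ·-mono-≤ (square-nonNeg (6ℚ · η)) (square-nonNeg (6ℚ · η)) κ≤ κ≤ ⟩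
        36ℚ · C₁ m · ε · (36ℚ · C₁ m · ε)          ≡⟨ ·-interchange (36ℚ · C₁ m) ε (36ℚ · C₁ m) ε ⟩
        L m · (ε · ε)                              ≤⟨ ·-monoˡ-≤ 0≤L (·-monoˡ-≤ 0≤ε ε≤1) ⟩
        L m · (ε · 1ℚ)                             ≡⟨ cong (L m ·_) (*-identityʳ ε) ⟩
        L m · ε                                    ∎
      x≤6η·choose2 : x ≤ℚ 6ℚ · η · choose2 n
      x≤6η·choose2 = begin
        x                             ≤⟨ x≤½M ⟩
        ½ · M                         ≤⟨ ·-monoˡ-≤ (nonNegative⁻¹ ½) M≤ ⟩
        ½ · (3ℚ · (η · (N · N)))      ≤⟨ ·-monoˡ-≤ (nonNegative⁻¹ ½) (·-monoˡ-≤ (nonNegative⁻¹ 3ℚ) (·-monoˡ-≤ η-nonNeg (N²≤4·choose2 n 2≤n))) ⟩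
        ½ · (3ℚ · (η · (4ℚ · choose2 n)))    ≡⟨ rearrange η (choose2 n) ⟩
        6ℚ · η · choose2 n                   ∎
        where
        rearrange : ∀ η y → ½ · (3ℚ · (η · (4ℚ · y))) ≡ 6ℚ · η · y
        rearrange = solve-∀ ℚ-ring

    κ : ℚ
    κ = e + 3ℚ · η

    -- κ² ≤ 2 e² + 18 η² ≤ 8 ε + 18 C₁ ε ≤ 26 C₁ ε, as C₁ ≥ 1.
    κ²≤Lε : κ · κ ≤ℚ L m · ε
    κ²≤Lε = ≤-trans
      (≤-from-difference
        (+-nonNeg (+-nonNeg (square-nonNeg (e - 3ℚ · η)) (·-nonNeg (nonNegative⁻¹ 2ℚ) (p≤q⇒0≤q-p e²≤4ε)))
                  (·-nonNeg (ℕ→ℚ-nonNeg 18) (p≤q⇒0≤q-p η²≤C₁·ε)))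
        (identity e η ε (C₁ m · ε)))
      (≤-trans (≤-from-difference (·-nonNeg (·-nonNeg (ℕ→ℚ-nonNeg 8) (p≤q⇒0≤q-p (1≤C₁ m))) 0≤ε) (identity′ (C₁ m) ε))
        (·-monoʳ-≤ 0≤ε (≤-trans (·-monoʳ-≤ 0≤C₁ (ℕ→ℚ-mono-≤ {26} {36} (ℕ.m≤m+n 26 10)))
          (subst (_≤ℚ L m) (*-identityʳ (36ℚ · C₁ m)) (·-monoˡ-≤ (·-nonNeg (ℕ→ℚ-nonNeg 36) 0≤C₁) (≤-trans (ℕ→ℚ-mono-≤ (s≤s {n = 35} z≤n)) (36≤36·C₁ m)))))))
      where
      identity : ∀ e η ε w → ℕ→ℚ 8 · ε + ℕ→ℚ 18 · w - (e + 3ℚ · η) · (e + 3ℚ · η)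
        ≡ (e - 3ℚ · η) · (e - 3ℚ · η) + 2ℚ · (4ℚ · ε - e · e) + ℕ→ℚ 18 · (w - η · η)
      identity = solve-∀ ℚ-ring
      identity′ : ∀ c ε → ℕ→ℚ 26 · c · ε - (ℕ→ℚ 8 · ε + ℕ→ℚ 18 · (c · ε)) ≡ ℕ→ℚ 8 · (c - 1ℚ) · ε
      identity′ = solve-∀ ℚ-ring

    -- The part deviates from n/2 by w/2, and floor and ceiling only help. For the two parts, `w` is
    -- the total of the sign vector and its negative.
    size-bound : ∀ z w → ℕ→ℚ z ≡ ½ · (N + w) → w · w ≤ℚ κ · (N · N) → SizeOK ((4 ÷ℕ 1) · ε) n z
    size-bound z w z≡ w²≤ =
      deviation (ℕ→ℚ ⌊ n /2⌋ - ℕ→ℚ z) (½ · (- w)) (≤-trans (+-monoˡ-≤ (- ℕ→ℚ z) (⌊n/2⌋≤½·n n)) (≤-reflexive (trans (cong (λ r → ½ · N - r) z≡) (below N w)))) (neg-square w) ,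
      deviation (ℕ→ℚ z - ℕ→ℚ ⌈ n /2⌉) (½ · w) (≤-trans (+-monoʳ-≤ (ℕ→ℚ z) (neg-antimono-≤ (½·n≤⌈n/2⌉ n))) (≤-reflexive (trans (cong (λ r → r - ½ · N) z≡) (above N w)))) (square w)
      where
      below : ∀ m w → ½ · m - ½ · (m + w) ≡ ½ · (- w)
      below = solve-∀ ℚ-ring
      above : ∀ m w → ½ · (m + w) - ½ · m ≡ ½ · w
      above = solve-∀ ℚ-ring
      neg-square : ∀ w → w · w - ½ · (- w) · (½ · (- w)) ≡ (½ + ½ · ½) · (w · w)
      neg-square = solve-∀ ℚ-ring
      square : ∀ w → w · w - ½ · w · (½ · w) ≡ (½ + ½ · ½) · (w · w)
      square = solve-∀ ℚ-ring
      deviation : ∀ x g → x ≤ℚ g → w · w - g · g ≡ (½ + ½ · ½) · (w · w) → LeRoot32 ((4 ÷ℕ 1) · ε) x (ℕ→ℚ n)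
      deviation x g x≤g g² = leRoot32 {L m} {ε} {κ} {g} x (ℕ→ℚ n) 0≤ε 0≤L L·ε≤1 ε-small (+-nonNeg e-nonNeg (·-nonNeg (nonNegative⁻¹ 3ℚ) η-nonNeg)) κ²≤Lε x≤g
        (≤-trans {g · g} {w · w} (≤-from-difference (·-nonNeg (nonNegative⁻¹ (½ + ½ · ½)) (square-nonNeg w)) g²) w²≤)

    total²-bound : ∀ {α M} → total α · total α ≤ℚ E + M → M ≤ℚ 3ℚ · (η · (N · N)) → total α · total α ≤ℚ κ · (N · N)
    total²-bound {α} {M} Y²≤ M≤ = ≤-trans Y²≤ (≤-trans (+-monoʳ-≤ E M≤)
      (≤-reflexive (trans (cong (_+ 3ℚ · (η · (N · N))) E≡e·N²) (identity e η (N · N)))))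
      where
      identity : ∀ e η m → e · m + 3ℚ · (η · m) ≡ (e + 3ℚ · η) · m
      identity = solve-∀ ℚ-ring

    sizes : ∀ {α} → total α · total α ≤ℚ κ · (N · N) →
      SizeOK ((4 ÷ℕ 1) · ε) n (card (X α)) × SizeOK ((4 ÷ℕ 1) · ε) n (n ∸ card (X α))
    sizes {α} Y²≤ = size-bound (card (X α)) (total α) (card-X α) Y²≤ , size-bound (n ∸ card (X α)) (- total α) (card-complement α) (subst (_≤ℚ κ · (N · N)) (sym (neg-·-neg (total α))) Y²≤)

    -- Here `s` mostly agrees with y_i y_j, so the edges inside the parts are mostly red and the
    -- crossing ones blue.
    blue-bipartite : ∀ α → N · N - form α α ≤ℚ 3ℚ · (η · (N · N)) → DeltaBipartiteRoot32 ((4 ÷ℕ 1) · ε) n c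
    blue-bipartite α M≤ = X α , proj₁ ok , proj₂ ok , inj₂ (symDiff-bound (ℕ→ℚ (symDiffBlue n c (X α))) (symDiffBlue≤ α) M≤)
      where
      ok : SizeOK ((4 ÷ℕ 1) · ε) n (card (X α)) × SizeOK ((4 ÷ℕ 1) · ε) n (n ∸ card (X α))
      ok = sizes {α} (total²-bound {α} (total²≤ α) M≤)

    red-bipartite : ∀ α → N · N - - form α α ≤ℚ 3ℚ · (η · (N · N)) → DeltaBipartiteRoot32 ((4 ÷ℕ 1) · ε) n c
    red-bipartite α M≤ = X α , proj₁ ok , proj₂ ok , inj₁ (symDiff-bound (ℕ→ℚ (symDiffRed n c (X α))) (symDiffRed≤ α) M≤)
      where
      ok : SizeOK ((4 ÷ℕ 1) · ε) n (card (X α)) × SizeOK ((4 ÷ℕ 1) · ε) n (n ∸ card (X α))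
      ok = sizes {α} (total²-bound {α} (total²≤′ α) M≤)

    bipartite : DeltaBipartiteRoot32 ((4 ÷ℕ 1) · ε) n c
    bipartite = from-form (large-form e≤1 η≤1)
      where
      from-form : (Σ (Fin n → Bool) λ α → Σ (Fin n → Bool) λ β → N · N - form α β ≤ℚ η · (N · N)) → DeltaBipartiteRoot32 ((4 ÷ℕ 1) · ε) n c
      from-form (α , β , N²-form≤) =
        [ (λ blue → blue-bipartite α (≤-trans blue (·-monoˡ-≤ (nonNegative⁻¹ 3ℚ) N²-form≤)))
        , (λ red → red-bipartite α (≤-trans red (·-monoˡ-≤ (nonNegative⁻¹ 3ℚ) N²-form≤))) ]′ (form-diagonal-large α β)

-- A closed walk consists of `i`, `j` and a path with m + 1 vertices. As 4 t does not reduce to this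
-- shape, the length is a variable `K` with an equation.
stability : ∀ K m → K ≡ suc (suc (suc m)) → Σ ℚ λ ε₀ → 0ℚ < ε₀ ×
  ((ε : ℚ) → 0ℚ < ε → ε ≤ℚ ε₀ → Σ ℕ λ n₀ → (n : ℕ) → n₀ ≤ n →
    (c : Colouring n) → (∀ i j → c i j ≡ c j i) →
    (1ℚ - ε) · (n ÷ℕ K) · (((n ∸ 1) ÷ℕ 2) ^ℚ (K ∸ 1)) < count (isRootedAlt c) (allVecs n K) ÷ℕ K →
    DeltaBipartiteRoot32 ((4 ÷ℕ 1) · ε) n c)
stability _ m refl = inv (L m · L m) , 0<ε₀ , λ ε 0<ε ε≤ε₀ →
  let n₁ , large = archimedean 0<ε (suc (suc m))
      ε-small = subst (L m · L m · ε ≤ℚ_) (inv-inverse 0<L²) (·-monoˡ-≤ (<⇒≤ 0<L²) ε≤ε₀)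
      ε≤1 = ≤-trans (subst (_≤ℚ L m · L m · ε) (*-identityˡ ε) (·-monoʳ-≤ (<⇒≤ 0<ε) 1≤L²)) ε-small
  -- The summand 2 serves N² ≤ 4 C(n,2), and `n₁` makes n ε at least the exponent m + 2.
  in 2 ℕ.+ n₁ , λ n n₀≤n c c-sym many →
  let 2≤n = ℕ.≤-trans (ℕ.m≤m+n 2 n₁) n₀≤n
      1≤n = ℕ.≤-trans (ℕ.n≤1+n 1) 2≤n
      0<n = <-≤-trans (positive⁻¹ 1ℚ) (ℕ→ℚ-mono-≤ 1≤n)
  in Coloured.Dense.bipartite c c-sym 0<n 2≤n (<⇒≤ 0<ε) m ε-small
       (Coloured.walks-from-cycles c c-sym 0<n 1≤n (<⇒≤ 0<ε) ε≤1 (suc (suc m)) (large n (ℕ.≤-trans (ℕ.m≤n+m n₁ 2) n₀≤n))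
         (÷-cancel-< (1ℚ - ε) (((n ∸ 1) ÷ℕ 2) ^ℚ suc (suc m)) n (count (isRootedAlt c) (allVecs n (suc (suc (suc m))))) (suc (suc m)) many))
  where
  1≤L² : 1ℚ ≤ℚ L m · L m
  1≤L² = ·-mono-≤ {1ℚ} {L m} {1ℚ} {L m} 0≤1 0≤1 1≤L 1≤L
    where
    1≤L : 1ℚ ≤ℚ L m
    1≤L = ≤-trans (ℕ→ℚ-mono-≤ (s≤s {n = 35} z≤n)) (36≤L m)
  0<L² : 0ℚ < L m · L m
  0<L² = <-≤-trans (positive⁻¹ 1ℚ) 1≤L²
  0<ε₀ : 0ℚ < inv (L m · L m)
  0<ε₀ = ≰⇒> λ ε₀≤0 → p<q∧q≤p⇒⊥ (positive⁻¹ 1ℚ)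
    (subst₂ _≤ℚ_ (inv-inverse 0<L²) (*-zeroʳ (L m · L m)) (·-monoˡ-≤ (<⇒≤ 0<L²) ε₀≤0))

theorem6p1 : (t : ℕ) → 2 ≤ t →
    Σ ℚ λ ε₀ → 0ℚ < ε₀ ×
    ((ε : ℚ) → 0ℚ < ε → ε ≤ℚ ε₀ →
    Σ ℕ λ n₀ → (n : ℕ) → n₀ ≤ n →
    (c : Colouring n) → (∀ i j → c i j ≡ c j i) →
    (1ℚ - ε) · (n ÷ℕ (4 * t)) · (((n ∸ 1) ÷ℕ 2) ^ℚ (4 * t ∸ 1))
    < altCycles n c t →
    DeltaBipartiteRoot32 ((4 ÷ℕ 1) · ε) n c)
theorem6p1 (suc t) 2≤t = stability (4 * suc t) (4 * suc t ∸ 3) (sym (ℕ.m+[n∸m]≡n (ℕ.≤-trans (ℕ.n≤1+n 3) (ℕ.m≤m*n 4 (suc t)))))
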